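{- Let $f(x)=a_1x+a_2\frac{x^2}{2!}+a_3\frac{x^3}{3!}+\cdots\in\mathbf{C}[[x]]$ be a formal power series with $a_1\neq 0$, and let $f^{\langle -1\rangle}(x)\in\mathbf{C}[[x]]$ be its inverse under composition. Then $$f^{\langle -1\rangle}(x)=\ln \sum_{m\ge 0} \left.\left(\frac{1}{f'(x)}\frac{d}{dx}\right)^m\left(e^x\right)\right|_{x=0}\frac{x^m}{m!}.$$
   Context: $\mathbf{C}[[x]]$ is the algebra of formal power series with complex coefficients. Formal power series with zero constant term and nonzero linear coefficient form a group under composition $(f\diamond g)(x)=f(g(x))$ with unit $x$; $f^{\langle -1\rangle}$ is the inverse of $f$ in this group, i.e. $f(f^{\langle -1\rangle}(x))=x$. Since $a_1\ne0$, $1/f'(x)\in\mathbf{C}[[x]]$. The operator $\left(\frac{1}{f'(x)}\frac{d}{dx}\right)^m$ is the $m$-fold iterate of the map $h\mapsto \frac{1}{f'(x)}h'(x)$ on $\mathbf{C}[[x]]$ (the identity for $m=0$); $e^x=\sum_{k\ge0}x^k/k!$; $|_{x=0}$ denotes taking the constant term. The series inside the logarithm has constant term $1$, and $\ln(1+h)=\sum_{k\ge1}(-1)^{k-1}h^k/k$ for a formal power series $h$ with zero constant term. -}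

module Defs where

open import Algebra.Apartness.Bundles using (HeytingCommutativeRing; HeytingField)
open import Algebra.Apartness.Structures using (IsHeytingField)
open import Algebra.Bundles using (CommutativeRing; Semiring)
import Algebra.Apartness.Properties.HeytingCommutativeRing as HCRProperties
import Algebra.Definitions.RawMonoid as RawMonoidDefinitions
import Algebra.Definitions.RawSemiring as RawSemiringDefinitions
import Algebra.Properties.CommutativeMonoid.Sum as SumProperties
import Algebra.Properties.Ring as RingProperties
open import Algebra.Structures using (IsCommutativeRing)
open import Data.Empty using (⊥-elim)
open import Data.Fin.Base as Fin using (Fin; toℕ)
open import Data.Nat.Base as ℕ using (ℕ; zero; suc; _!)
import Data.Nat.Properties as ℕ
open import Data.Product.Base using (∃-syntax; _×_; _,_; proj₁; proj₂; uncurry)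
open import Data.Rational.Base as ℚ using (ℚ; 0ℚ; 1ℚ; ½; ∣_∣; _<_; _≤_; 1/_)
import Data.Rational.Properties as ℚ
open import Data.Rational.Solver using (module +-*-Solver)
open import Data.Sum.Base using (_⊎_; inj₁; inj₂; [_,_]′)
open import Data.Vec.Base using (Vec; []; _∷_; head; lookup)
open import Function.Base using (id; _∘_)
open import Level using (0ℓ)
open import Relation.Binary.PropositionalEquality
  using (_≡_; _≢_; refl; sym; trans; cong; cong₂; subst; module ≡-Reasoning)
import Relation.Binary.Reasoning.Setoid as SetoidReasoning
open import Relation.Binary.Structures using (IsEquivalence)
open import Relation.Nullary using (¬_; yes; no; contradiction)

private
  halve : ∀ {ε} → 0ℚ < ε → ∃[ δ ] 0ℚ < δ × δ ℚ.+ δ ≡ ε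
  halve {ε} ε>0 = ½ ℚ.* ε
    , subst (_< ½ ℚ.* ε) (ℚ.*-zeroʳ ½) (ℚ.*-monoʳ-<-pos ½ ε>0)
    , trans (sym (ℚ.*-distribʳ-+ ε ½ ½)) (ℚ.*-identityˡ ε)

  0<1 : 0ℚ < 1ℚ
  0<1 = ℚ.positive⁻¹ 1ℚ

  *-pos : ∀ {p q} → 0ℚ < p → 0ℚ < q → 0ℚ < p ℚ.* q
  *-pos {p} {q} p>0 q>0 =
    ℚ.positive⁻¹ (p ℚ.* q) {{ℚ.pos*pos⇒pos p {{ℚ.positive p>0}} q {{ℚ.positive q>0}}}}

  0<⇒≢0 : ∀ {p} → 0ℚ < p → p ≢ 0ℚ
  0<⇒≢0 p>0 p≡0 = ℚ.<-irrefl (sym p≡0) p>0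

  *-mono-≤ : ∀ {p q r s} → 0ℚ ≤ p → 0ℚ ≤ s → p ≤ q → r ≤ s → p ℚ.* r ≤ q ℚ.* s
  *-mono-≤ {p} {q} {r} {s} p≥0 s≥0 p≤q r≤s = ℚ.≤-trans
    (ℚ.*-monoˡ-≤-nonNeg p {{ℚ.nonNegative p≥0}} r≤s)
    (ℚ.*-monoʳ-≤-nonNeg s {{ℚ.nonNegative s≥0}} p≤q)

  ∣p-q∣≡∣q-p∣ : ∀ p q → ∣ p ℚ.- q ∣ ≡ ∣ q ℚ.- p ∣
  ∣p-q∣≡∣q-p∣ p q = trans (cong ∣_∣ (+-*-Solver.solve 2
    (λ x y → x :- y := :- (y :- x)) refl p q)) (ℚ.∣-p∣≡∣p∣ (q ℚ.- p))
    where open +-*-Solver using (_:-_; :-_; _:=_)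

  ∣p∣≤∣q∣+∣p-q∣ : ∀ p q → ∣ p ∣ ≤ ∣ q ∣ ℚ.+ ∣ p ℚ.- q ∣
  ∣p∣≤∣q∣+∣p-q∣ p q = subst (λ r → ∣ r ∣ ≤ ∣ q ∣ ℚ.+ ∣ p ℚ.- q ∣)
    (+-*-Solver.solve 2 (λ x y → y :+ (x :- y) := x) refl p q)
    (ℚ.∣p+q∣≤∣p∣+∣q∣ q (p ℚ.- q))
    where open +-*-Solver using (_:-_; _:+_; _:=_)

  triangle : ∀ p q r → ∣ p ℚ.- q ∣ ≤ ∣ r ℚ.- q ∣ ℚ.+ ∣ p ℚ.- r ∣
  triangle p q r = subst (λ t → ∣ t ∣ ≤ ∣ r ℚ.- q ∣ ℚ.+ ∣ p ℚ.- r ∣)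
    (+-*-Solver.solve 3 (λ x y z → (z :- y) :+ (x :- z) := x :- y) refl p q r)
    (ℚ.∣p+q∣≤∣p∣+∣q∣ (r ℚ.- q) (p ℚ.- r))
    where open +-*-Solver using (_:-_; _:+_; _:=_)

  +-interchange-- : ∀ p q r s → (p ℚ.- q) ℚ.+ (r ℚ.- s) ≡ (p ℚ.+ r) ℚ.- (q ℚ.+ s)
  +-interchange-- = +-*-Solver.solve 4 (λ p q r s → (p :- q) :+ (r :- s) := (p :+ r) :- (q :+ s)) refl
    where open +-*-Solver using (_:-_; _:+_; _:=_)

  *-difference : ∀ p q r s →
    (p ℚ.- q) ℚ.* r ℚ.+ (r ℚ.- s) ℚ.* q ≡ p ℚ.* r ℚ.- q ℚ.* s
  *-difference = +-*-Solver.solve 4 (λ p q r s → (p :- q) :* r :+ (r :- s) :* q := p :* r :- q :* s) refl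
    where open +-*-Solver using (_:-_; _:+_; _:*_; _:=_)

  half≤ : ∀ {δ ε p q} → δ ℚ.+ δ ≡ ε → ε ≤ p ℚ.+ q → q < δ → δ ≤ p
  half≤ {δ} {ε} {p} {q} δ+δ≡ε ε≤p+q q<δ with δ ℚ.≤? p
  ... | yes le = le
  ... | no ≰ = ⊥-elim (ℚ.<-irrefl refl (ℚ.<-≤-trans
        (subst (p ℚ.+ q <_) δ+δ≡ε (ℚ.+-mono-< (ℚ.≰⇒> ≰) q<δ)) ε≤p+q))

  p<p+p : ∀ {p} → 0ℚ < p → p < p ℚ.+ p
  p<p+p {p} p>0 = subst (_< p ℚ.+ p) (ℚ.+-identityˡ p) (ℚ.+-monoˡ-< p p>0)

  recip : ℚ → ℚ
  recip p with p ℚ.≟ 0ℚ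
  ... | yes _ = 0ℚ
  ... | no p≢0 = (1/ p) {{ℚ.≢-nonZero p≢0}}

  recip-inverse : ∀ {p} → p ≢ 0ℚ → p ℚ.* recip p ≡ 1ℚ
  recip-inverse {p} p≢0 with p ℚ.≟ 0ℚ
  ... | yes p≡0 = contradiction p≡0 p≢0
  ... | no p≢0′ = ℚ.*-inverseʳ p {{ℚ.≢-nonZero p≢0′}}

  recip-inverseˡ : ∀ {p} → 0ℚ < p → recip p ℚ.* p ≡ 1ℚ
  recip-inverseˡ {p} p>0 = trans (ℚ.*-comm (recip p) p) (recip-inverse (0<⇒≢0 p>0))

  recip-difference : ∀ p q → p ≢ 0ℚ → q ≢ 0ℚ →
    (ℚ.- (p ℚ.- q)) ℚ.* (recip p ℚ.* recip q) ≡ recip p ℚ.- recip q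
  recip-difference p q p≢0 q≢0 = difference (recip p) (recip q) (recip-inverse p≢0) (recip-inverse q≢0)
    where
    open ≡-Reasoning
    open +-*-Solver using (_:*_; _:-_; :-_; _:=_)
    difference : ∀ r s → p ℚ.* r ≡ 1ℚ → q ℚ.* s ≡ 1ℚ → (ℚ.- (p ℚ.- q)) ℚ.* (r ℚ.* s) ≡ r ℚ.- s
    difference r s pr≡1 qs≡1 = begin
      (ℚ.- (p ℚ.- q)) ℚ.* (r ℚ.* s)              ≡⟨ +-*-Solver.solve 4
        (λ p q r s → (:- (p :- q)) :* (r :* s) := r :* (q :* s) :- s :* (p :* r)) refl p q r s ⟩
      r ℚ.* (q ℚ.* s) ℚ.- s ℚ.* (p ℚ.* r)        ≡⟨ cong₂ (λ u v → r ℚ.* u ℚ.- s ℚ.* v) qs≡1 pr≡1 ⟩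
      r ℚ.* 1ℚ ℚ.- s ℚ.* 1ℚ                      ≡⟨ cong₂ ℚ._-_ (ℚ.*-identityʳ r) (ℚ.*-identityʳ s) ⟩
      r ℚ.- s                                    ∎

  recip-pos : ∀ {p} → 0ℚ < p → 0ℚ < recip p
  recip-pos {p} p>0 with p ℚ.≟ 0ℚ
  ... | yes p≡0 = contradiction p≡0 (0<⇒≢0 p>0)
  ... | no p≢0 = ℚ.positive⁻¹ _ {{ℚ.1/pos⇒pos p {{ℚ.positive p>0}}}}

  ∣recip∣≤ : ∀ {ε p} → 0ℚ < ε → ε ≤ ∣ p ∣ → p ≢ 0ℚ → ∣ recip p ∣ ≤ recip ε
  ∣recip∣≤ {ε} {p} ε>0 ε≤∣p∣ p≢0 = begin
    ∣ recip p ∣                      ≡⟨ ℚ.*-identityˡ _ ⟨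
    1ℚ ℚ.* ∣ recip p ∣               ≡⟨ cong (ℚ._* _) (recip-inverseˡ ε>0) ⟨
    recip ε ℚ.* ε ℚ.* ∣ recip p ∣    ≤⟨ *-mono-≤ (ℚ.<⇒≤ (*-pos (recip-pos ε>0) ε>0)) (ℚ.0≤∣p∣ _)
                                          (ℚ.*-monoˡ-≤-nonNeg (recip ε) {{ℚ.nonNegative (ℚ.<⇒≤ (recip-pos ε>0))}} ε≤∣p∣)
                                          ℚ.≤-refl ⟩
    recip ε ℚ.* ∣ p ∣ ℚ.* ∣ recip p ∣ ≡⟨ ℚ.*-assoc (recip ε) ∣ p ∣ ∣ recip p ∣ ⟩
    recip ε ℚ.* (∣ p ∣ ℚ.* ∣ recip p ∣) ≡⟨ cong (recip ε ℚ.*_) (trans (sym (ℚ.∣p*q∣≡∣p∣*∣q∣ p _)) (cong ∣_∣ (recip-inverse p≢0))) ⟩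
    recip ε ℚ.* 1ℚ                   ≡⟨ ℚ.*-identityʳ _ ⟩
    recip ε                          ∎
    where open ℚ.≤-Reasoning

-- The index n of a sequence has stage n; the index (m , n) of a double
-- sequence has stage m ⊓ n, so that "eventually" ranges over all m, n ≥ N.

Eventually : {I : Set} → (I → ℕ) → (I → Set) → Set
Eventually stage P = ∃[ N ] (∀ i → N ℕ.≤ stage i → P i)

Vanishing : {I : Set} → (I → ℕ) → (I → ℚ) → Set
Vanishing stage s = ∀ ε → 0ℚ < ε → Eventually stage (λ i → ∣ s i ∣ < ε)

Bounded : {I : Set} → (I → ℕ) → (I → ℚ) → Set
Bounded stage s = ∃[ B ] 0ℚ < B × Eventually stage (λ i → ∣ s i ∣ ≤ B)

private
  module _ {I : Set} {stage : I → ℕ} where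

    infixr 4 _and_

    _and_ : ∀ {P Q} → Eventually stage P → Eventually stage Q →
            Eventually stage (λ i → P i × Q i)
    (M , p) and (N , q) = M ℕ.⊔ N , λ i le →
      p i (ℕ.≤-trans (ℕ.m≤m⊔n M N) le) , q i (ℕ.≤-trans (ℕ.m≤n⊔m M N) le)

    infixl 3 _thus_

    _thus_ : ∀ {P Q : I → Set} → Eventually stage P → (∀ i → P i → Q i) →
             Eventually stage Q
    (N , p) thus f = N , λ i le → f i (p i le)

    always : ∀ {P : I → Set} → (∀ i → P i) → Eventually stage P
    always p = 0 , λ i _ → p i

    vanishing-cong : ∀ {s t} → Eventually stage (λ i → s i ≡ t i) →
                     Vanishing stage s → Vanishing stage t
    vanishing-cong s≡t s→0 ε ε>0 =
      s≡t and s→0 ε ε>0 thus λ i (eq , lt) → subst (λ r → ∣ r ∣ < ε) eq lt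

    zero-vanishing : ∀ {s} → (∀ i → s i ≡ 0ℚ) → Vanishing stage s
    zero-vanishing s≡0 ε ε>0 = always λ i → subst (λ r → ∣ r ∣ < ε) (sym (s≡0 i)) ε>0

    +-vanishing : ∀ {s t} → Vanishing stage s → Vanishing stage t →
                  Vanishing stage (λ i → s i ℚ.+ t i)
    +-vanishing {s} {t} s→0 t→0 ε ε>0 with halve ε>0
    ... | δ , δ>0 , δ+δ≡ε = s→0 δ δ>0 and t→0 δ δ>0 thus λ i (p , q) →
        ℚ.≤-<-trans (ℚ.∣p+q∣≤∣p∣+∣q∣ (s i) (t i))
          (subst (∣ s i ∣ ℚ.+ ∣ t i ∣ <_) δ+δ≡ε (ℚ.+-mono-< p q))

    neg-vanishing : ∀ {s} → Vanishing stage s → Vanishing stage (λ i → ℚ.- s i)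
    neg-vanishing {s} s→0 ε ε>0 = s→0 ε ε>0 thus λ i → subst (_< ε) (sym (ℚ.∣-p∣≡∣p∣ (s i)))

    *-vanishing : ∀ {s t} → Vanishing stage s → Bounded stage t →
                  Vanishing stage (λ i → s i ℚ.* t i)
    *-vanishing {s} {t} s→0 (B , B>0 , t≤B) ε ε>0 =
      s→0 _ (*-pos ε>0 (recip-pos B>0)) and t≤B thus λ i (p , q) → begin-strict
        ∣ s i ℚ.* t i ∣         ≡⟨ ℚ.∣p*q∣≡∣p∣*∣q∣ (s i) (t i) ⟩
        ∣ s i ∣ ℚ.* ∣ t i ∣     ≤⟨ ℚ.*-monoˡ-≤-nonNeg ∣ s i ∣ {{ℚ.nonNegative (ℚ.0≤∣p∣ (s i))}} q ⟩
        ∣ s i ∣ ℚ.* B           <⟨ ℚ.*-monoˡ-<-pos B {{ℚ.positive B>0}} p ⟩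
        ε ℚ.* recip B ℚ.* B     ≡⟨ ℚ.*-assoc ε (recip B) B ⟩
        ε ℚ.* (recip B ℚ.* B)   ≡⟨ cong (ε ℚ.*_) (recip-inverseˡ B>0) ⟩
        ε ℚ.* 1ℚ                ≡⟨ ℚ.*-identityʳ ε ⟩
        ε                       ∎
      where open ℚ.≤-Reasoning

    *-bounded : ∀ {s t} → Bounded stage s → Bounded stage t →
                Bounded stage (λ i → s i ℚ.* t i)
    *-bounded {s} {t} (B , B>0 , s≤B) (C , C>0 , t≤C) =
      B ℚ.* C , *-pos B>0 C>0 , (s≤B and t≤C thus λ i (p , q) →
        subst (_≤ B ℚ.* C) (sym (ℚ.∣p*q∣≡∣p∣*∣q∣ (s i) (t i)))
          (*-mono-≤ (ℚ.0≤∣p∣ (s i)) (ℚ.<⇒≤ C>0) p q))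

  ⊓-stage : ℕ × ℕ → ℕ
  ⊓-stage = uncurry ℕ._⊓_

  eventually-fst : ∀ {P : ℕ → Set} → Eventually id P → Eventually ⊓-stage (P ∘ proj₁)
  eventually-fst (N , p) = N , λ (m , n) le → p m (ℕ.≤-trans le (ℕ.m⊓n≤m m n))

  eventually-snd : ∀ {P : ℕ → Set} → Eventually id P → Eventually ⊓-stage (P ∘ proj₂)
  eventually-snd (N , p) = N , λ (m , n) le → p n (ℕ.≤-trans le (ℕ.m⊓n≤n m n))

  bounded-fst : ∀ {s} → Bounded id s → Bounded ⊓-stage (s ∘ proj₁)
  bounded-fst (B , B>0 , s≤B) = B , B>0 , eventually-fst s≤B

  bounded-snd : ∀ {s} → Bounded id s → Bounded ⊓-stage (s ∘ proj₂)
  bounded-snd (B , B>0 , s≤B) = B , B>0 , eventually-snd s≤B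

Cauchy : (ℕ → ℚ) → Set
Cauchy s = Vanishing (uncurry ℕ._⊓_) (λ (m , n) → s m ℚ.- s n)

record ℝ : Set where
  no-eta-equality
  constructor mkℝ
  field
    seq    : ℕ → ℚ
    cauchy : Cauchy seq

open ℝ public

infix 4 _≈ᴿ_ _#ᴿ_

_≈ᴿ_ : ℝ → ℝ → Set
x ≈ᴿ y = Vanishing id (λ n → seq x n ℚ.- seq y n)

-- Apartness, the constructive form of x ≠ y: the difference is eventually
-- bounded away from 0.  It is tight, i.e. ¬ x #ᴿ y implies x ≈ᴿ y.
_#ᴿ_ : ℝ → ℝ → Set
x #ᴿ y = ∃[ ε ] 0ℚ < ε × Eventually id (λ n → ε ≤ ∣ seq x n ℚ.- seq y n ∣)

private
  bounded-seq : ∀ x → Bounded id (seq x)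
  bounded-seq x with cauchy x 1ℚ 0<1
  ... | N , close = ∣ seq x N ∣ ℚ.+ 1ℚ
      , ℚ.+-mono-≤-< (ℚ.0≤∣p∣ (seq x N)) 0<1
      , N , λ n N≤n → ℚ.≤-trans (∣p∣≤∣q∣+∣p-q∣ (seq x n) (seq x N))
          (ℚ.+-monoʳ-≤ ∣ seq x N ∣ (ℚ.<⇒≤ (close (n , N) (ℕ.⊓-glb N≤n ℕ.≤-refl))))

infixl 6 _+ᴿ_ _-ᴿ_
infixl 7 _*ᴿ_
infix  8 -ᴿ_

_+ᴿ_ : ℝ → ℝ → ℝ
seq    (x +ᴿ y) n = seq x n ℚ.+ seq y n
cauchy (x +ᴿ y)   = vanishing-cong
  (always λ (m , n) → +-interchange-- (seq x m) (seq x n) (seq y m) (seq y n))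
  (+-vanishing (cauchy x) (cauchy y))

-ᴿ_ : ℝ → ℝ
seq    (-ᴿ x) n = ℚ.- seq x n
cauchy (-ᴿ x)   = vanishing-cong
  (always λ (m , n) → ℚ.neg-distrib-+ (seq x m) (ℚ.- seq x n))
  (neg-vanishing (cauchy x))

_-ᴿ_ : ℝ → ℝ → ℝ
x -ᴿ y = x +ᴿ (-ᴿ y)

_*ᴿ_ : ℝ → ℝ → ℝ
seq    (x *ᴿ y) n = seq x n ℚ.* seq y n
cauchy (x *ᴿ y)   = vanishing-cong
  (always λ (m , n) → *-difference (seq x m) (seq x n) (seq y m) (seq y n))
  (+-vanishing (*-vanishing (cauchy x) (bounded-fst (bounded-seq y)))
               (*-vanishing (cauchy y) (bounded-snd (bounded-seq x))))

fromℚ : ℚ → ℝ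
seq    (fromℚ q) n = q
cauchy (fromℚ q)   = zero-vanishing λ _ → ℚ.+-inverseʳ q

0ᴿ 1ᴿ : ℝ
0ᴿ = fromℚ 0ℚ
1ᴿ = fromℚ 1ℚ

private
  pointwise⇒≈ : ∀ {x y} → (∀ n → seq x n ≡ seq y n) → x ≈ᴿ y
  pointwise⇒≈ {x} {y} x≡y = zero-vanishing λ n →
    trans (cong (ℚ._- seq y n) (x≡y n)) (ℚ.+-inverseʳ (seq y n))

  ≈ᴿ-refl : ∀ {x} → x ≈ᴿ x
  ≈ᴿ-refl {x} = pointwise⇒≈ {x} {x} λ _ → refl

  ≈ᴿ-sym : ∀ {x y} → x ≈ᴿ y → y ≈ᴿ x
  ≈ᴿ-sym {x} {y} x≈y ε ε>0 = x≈y ε ε>0 thus λ n →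
    subst (_< ε) (∣p-q∣≡∣q-p∣ (seq x n) (seq y n))

  ≈ᴿ-trans : ∀ {x y z} → x ≈ᴿ y → y ≈ᴿ z → x ≈ᴿ z
  ≈ᴿ-trans {x} {y} {z} x≈y y≈z = vanishing-cong (always λ n →
    +-*-Solver.solve 3 (λ a b c → (a :- b) :+ (b :- c) := a :- c)
      refl (seq x n) (seq y n) (seq z n))
    (+-vanishing x≈y y≈z)
    where open +-*-Solver using (_:+_; _:-_; _:=_)

  +ᴿ-cong : ∀ {x x′ y y′} → x ≈ᴿ x′ → y ≈ᴿ y′ → x +ᴿ y ≈ᴿ x′ +ᴿ y′
  +ᴿ-cong {x} {x′} {y} {y′} p q = vanishing-cong
    (always λ n → +-interchange-- (seq x n) (seq x′ n) (seq y n) (seq y′ n))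
    (+-vanishing p q)

  *ᴿ-cong : ∀ {x x′ y y′} → x ≈ᴿ x′ → y ≈ᴿ y′ → x *ᴿ y ≈ᴿ x′ *ᴿ y′
  *ᴿ-cong {x} {x′} {y} {y′} p q = vanishing-cong
    (always λ n → *-difference (seq x n) (seq x′ n) (seq y n) (seq y′ n))
    (+-vanishing (*-vanishing p (bounded-seq y)) (*-vanishing q (bounded-seq x′)))

  -ᴿ-cong : ∀ {x y} → x ≈ᴿ y → -ᴿ x ≈ᴿ -ᴿ y
  -ᴿ-cong {x} {y} p = vanishing-cong
    (always λ n → ℚ.neg-distrib-+ (seq x n) (ℚ.- seq y n)) (neg-vanishing p)

  #ᴿ-resp-≈0 : ∀ {x y} → x ≈ᴿ y → x #ᴿ 0ᴿ → y #ᴿ 0ᴿ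
  #ᴿ-resp-≈0 {x} {y} x≈y (ε , ε>0 , far) with halve ε>0
  ... | δ , δ>0 , δ+δ≡ε = δ , δ>0 , (far and x≈y δ δ>0 thus λ n (p , q) →
      half≤ δ+δ≡ε (ℚ.≤-trans p (ℚ.≤-trans
        (∣p∣≤∣q∣+∣p-q∣ (seq x n ℚ.- 0ℚ) (seq y n ℚ.- 0ℚ))
        (ℚ.≤-reflexive (cong (λ r → ∣ seq y n ℚ.- 0ℚ ∣ ℚ.+ ∣ r ∣)
          (+-*-Solver.solve 2 (λ a b → (a :- con 0ℚ) :- (b :- con 0ℚ) := a :- b)
            refl (seq x n) (seq y n)))))) q)
    where open +-*-Solver using (_:-_; _:=_; con)

  near⊎apart-0 : ∀ s → Cauchy s → ∀ ε → 0ℚ < ε →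
    Eventually id (λ n → ∣ s n ∣ < ε) ⊎ (∃[ η ] 0ℚ < η × Eventually id (λ n → η ≤ ∣ s n ∣))
  near⊎apart-0 s s-cauchy ε ε>0 with halve ε>0
  ... | δ , δ>0 , δ+δ≡ε with halve δ>0
  ... | η , η>0 , η+η≡δ with s-cauchy η η>0
  ... | N , close with ∣ s N ∣ ℚ.<? δ
  ... | yes near = inj₁ (N , λ n N≤n → ℚ.≤-<-trans (∣p∣≤∣q∣+∣p-q∣ (s n) (s N))
          (subst (∣ s N ∣ ℚ.+ ∣ s n ℚ.- s N ∣ <_) δ+δ≡ε (ℚ.+-mono-< near (ℚ.<-trans
            (close (n , N) (ℕ.⊓-glb N≤n ℕ.≤-refl))
            (subst (η <_) η+η≡δ (p<p+p η>0))))))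
  ... | no far = inj₂ (η , η>0 , N , λ n N≤n → half≤ η+η≡δ
          (ℚ.≤-trans (ℚ.≮⇒≥ far) (∣p∣≤∣q∣+∣p-q∣ (s N) (s n)))
          (close (N , n) (ℕ.⊓-glb ℕ.≤-refl N≤n)))

  near⊎apart : ∀ x y ε → 0ℚ < ε →
    Eventually id (λ n → ∣ seq x n ℚ.- seq y n ∣ < ε) ⊎ x #ᴿ y
  near⊎apart x y = near⊎apart-0 (λ n → seq x n ℚ.- seq y n) (cauchy (x -ᴿ y))

  #ᴿ-irrefl : ∀ {x y} → x ≈ᴿ y → ¬ x #ᴿ y
  #ᴿ-irrefl x≈y (ε , ε>0 , far) with x≈y ε ε>0 and far
  ... | N , both = let lt , le = both N ℕ.≤-refl in ℚ.<-irrefl refl (ℚ.<-≤-trans lt le)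

  #ᴿ-sym : ∀ {x y} → x #ᴿ y → y #ᴿ x
  #ᴿ-sym {x} {y} (ε , ε>0 , far) = ε , ε>0 , (far thus λ n →
    subst (ε ≤_) (∣p-q∣≡∣q-p∣ (seq x n) (seq y n)))

  #ᴿ-cotrans : ∀ {x y} → x #ᴿ y → ∀ z → x #ᴿ z ⊎ z #ᴿ y
  #ᴿ-cotrans {x} {y} (ε , ε>0 , far) z =
    let δ , δ>0 , δ+δ≡ε = halve ε>0 in
    [ (λ near → inj₂ (δ , δ>0 , (far and near thus λ n (p , q) →
          half≤ {q = ∣ seq x n ℚ.- seq z n ∣} δ+δ≡ε
            (ℚ.≤-trans p (triangle (seq x n) (seq y n) (seq z n))) q)))
    , inj₁
    ]′ (near⊎apart x z δ δ>0)

  ¬#ᴿ⇒≈ : ∀ x y → ¬ x #ᴿ y → x ≈ᴿ y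
  ¬#ᴿ⇒≈ x y ¬x#y ε ε>0 = [ id , (λ x#y → contradiction x#y ¬x#y) ]′ (near⊎apart x y ε ε>0)

  p-0≡p : ∀ p → p ℚ.- 0ℚ ≡ p
  p-0≡p p = ℚ.+-identityʳ p

  factor-apart : ∀ {ε B} p q → 0ℚ < B → ε ≤ ∣ p ℚ.* q ℚ.- 0ℚ ∣ → ∣ q ∣ ≤ B →
                 ε ℚ.* recip B ≤ ∣ p ℚ.- 0ℚ ∣
  factor-apart {ε} {B} p q B>0 ε≤∣pq∣ ∣q∣≤B = ℚ.*-cancelʳ-≤-pos B {{ℚ.positive B>0}} (begin
    ε ℚ.* recip B ℚ.* B     ≡⟨ ℚ.*-assoc ε (recip B) B ⟩
    ε ℚ.* (recip B ℚ.* B)   ≡⟨ cong (ε ℚ.*_) (recip-inverseˡ B>0) ⟩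
    ε ℚ.* 1ℚ                ≡⟨ ℚ.*-identityʳ ε ⟩
    ε                       ≤⟨ ε≤∣pq∣ ⟩
    ∣ p ℚ.* q ℚ.- 0ℚ ∣      ≡⟨ cong ∣_∣ (p-0≡p (p ℚ.* q)) ⟩
    ∣ p ℚ.* q ∣             ≡⟨ ℚ.∣p*q∣≡∣p∣*∣q∣ p q ⟩
    ∣ p ∣ ℚ.* ∣ q ∣         ≤⟨ ℚ.*-monoˡ-≤-nonNeg ∣ p ∣ {{ℚ.nonNegative (ℚ.0≤∣p∣ p)}} ∣q∣≤B ⟩
    ∣ p ∣ ℚ.* B             ≡⟨ cong (λ r → ∣ r ∣ ℚ.* B) (p-0≡p p) ⟨
    ∣ p ℚ.- 0ℚ ∣ ℚ.* B      ∎)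
    where open ℚ.≤-Reasoning

  *ᴿ-#0⇒ : ∀ x y → x *ᴿ y #ᴿ 0ᴿ → x #ᴿ 0ᴿ
  *ᴿ-#0⇒ x y (ε , ε>0 , far) = let B , B>0 , y≤B = bounded-seq y in
    ε ℚ.* recip B , *-pos ε>0 (recip-pos B>0) ,
    (far and y≤B thus λ n (p , q) → factor-apart (seq x n) (seq y n) B>0 p q)

  +ᴿ-#0⇒ : ∀ x y → x +ᴿ y #ᴿ 0ᴿ → x #ᴿ 0ᴿ ⊎ y #ᴿ 0ᴿ
  +ᴿ-#0⇒ x y x+y#0 =
    [ (λ (ε , ε>0 , far) → inj₁ (ε , ε>0 , (far thus λ n →
        subst (λ r → ε ≤ ∣ r ∣) (p+q-q≡p-0 (seq x n) (seq y n)))))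
    , inj₂
    ]′ (#ᴿ-cotrans {x +ᴿ y} {0ᴿ} x+y#0 y)
    where
    open +-*-Solver using (_:+_; _:-_; _:=_; con)
    p+q-q≡p-0 : ∀ p q → (p ℚ.+ q) ℚ.- q ≡ p ℚ.- 0ℚ
    p+q-q≡p-0 = +-*-Solver.solve 2 (λ p q → (p :+ q) :- q := p :- con 0ℚ) refl

  #0⇒recip-bounded : ∀ {x} → x #ᴿ 0ᴿ →
    Eventually id (λ n → seq x n ≢ 0ℚ) × Bounded id (λ n → recip (seq x n))
  #0⇒recip-bounded {x} (ε , ε>0 , far) = nonzero , recip ε , recip-pos ε>0 ,
    (far and nonzero thus λ n (p , q) → ∣recip∣≤ ε>0 (subst (λ r → ε ≤ ∣ r ∣) (p-0≡p _) p) q)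
    where
    nonzero : Eventually id (λ n → seq x n ≢ 0ℚ)
    nonzero = far thus λ n p x≡0 → ℚ.<-irrefl refl
      (ℚ.<-≤-trans ε>0 (subst (λ r → ε ≤ ∣ r ℚ.- 0ℚ ∣) x≡0 p))

recipᴿ : (x : ℝ) → x #ᴿ 0ᴿ → ℝ
seq    (recipᴿ x x#0) n = recip (seq x n)
cauchy (recipᴿ x x#0)   = let nonzero , bounded = #0⇒recip-bounded {x} x#0 in
  vanishing-cong
    (eventually-fst nonzero and eventually-snd nonzero thus λ (m , n) (p , q) →
      recip-difference (seq x m) (seq x n) p q)
    (*-vanishing (neg-vanishing (cauchy x)) (*-bounded (bounded-fst bounded) (bounded-snd bounded)))

private
  recipᴿ-inverse : ∀ x (x#0 : x #ᴿ 0ᴿ) → x *ᴿ recipᴿ x x#0 ≈ᴿ 1ᴿ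
  recipᴿ-inverse x x#0 = vanishing-cong {s = λ _ → 0ℚ}
    (proj₁ (#0⇒recip-bounded {x} x#0) thus λ n p →
      sym (cong (ℚ._- 1ℚ) (recip-inverse p)))
    (zero-vanishing λ _ → refl)

record ℂ : Set where
  no-eta-equality
  constructor _+i_
  field
    re im : ℝ

open ℂ public

infix 4 _≈ᶜ_ _#ᶜ_

record _≈ᶜ_ (z w : ℂ) : Set where
  constructor mk≈ᶜ
  field
    re-≈ : re z ≈ᴿ re w
    im-≈ : im z ≈ᴿ im w

data _#ᶜ_ (z w : ℂ) : Set where
  re-# : re z #ᴿ re w → z #ᶜ w
  im-# : im z #ᴿ im w → z #ᶜ w

infixl 6 _+ᶜ_ _-ᶜ_
infixl 7 _*ᶜ_
infix  8 -ᶜ_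

_+ᶜ_ _*ᶜ_ : ℂ → ℂ → ℂ
-ᶜ_ : ℂ → ℂ

re (z +ᶜ w) = re z +ᴿ re w
im (z +ᶜ w) = im z +ᴿ im w

re (-ᶜ z) = -ᴿ re z
im (-ᶜ z) = -ᴿ im z

re (z *ᶜ w) = re z *ᴿ re w -ᴿ im z *ᴿ im w
im (z *ᶜ w) = re z *ᴿ im w +ᴿ im z *ᴿ re w

_-ᶜ_ : ℂ → ℂ → ℂ
z -ᶜ w = z +ᶜ (-ᶜ w)

0ᶜ 1ᶜ : ℂ
0ᶜ = 0ᴿ +i 0ᴿ
1ᶜ = 1ᴿ +i 0ᴿ

private
  pointwiseᶜ : ∀ {z w} → (∀ n → seq (re z) n ≡ seq (re w) n) →
               (∀ n → seq (im z) n ≡ seq (im w) n) → z ≈ᶜ w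
  pointwiseᶜ {z} {w} p q =
    mk≈ᶜ (pointwise⇒≈ {re z} {re w} p) (pointwise⇒≈ {im z} {im w} q)

  ≈ᶜ-isEquivalence : IsEquivalence _≈ᶜ_
  ≈ᶜ-isEquivalence = record
    { refl  = λ {z} → mk≈ᶜ (≈ᴿ-refl {re z}) (≈ᴿ-refl {im z})
    ; sym   = λ {z} {w} (mk≈ᶜ p q) → mk≈ᶜ (≈ᴿ-sym {re z} {re w} p) (≈ᴿ-sym {im z} {im w} q)
    ; trans = λ {u} {v} {w} (mk≈ᶜ p q) (mk≈ᶜ p′ q′) →
        mk≈ᶜ (≈ᴿ-trans {re u} {re v} {re w} p p′) (≈ᴿ-trans {im u} {im v} {im w} q q′)
    }

  *ᶜ-cong : ∀ {z z′ w w′} → z ≈ᶜ z′ → w ≈ᶜ w′ → z *ᶜ w ≈ᶜ z′ *ᶜ w′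
  *ᶜ-cong {z} {z′} {w} {w′} (mk≈ᶜ p q) (mk≈ᶜ r s) = mk≈ᶜ
    (+ᴿ-cong {re z *ᴿ re w} {re z′ *ᴿ re w′} { -ᴿ (im z *ᴿ im w)} { -ᴿ (im z′ *ᴿ im w′)}
      (*ᴿ-cong {re z} {re z′} {re w} {re w′} p r)
      (-ᴿ-cong {im z *ᴿ im w} {im z′ *ᴿ im w′} (*ᴿ-cong {im z} {im z′} {im w} {im w′} q s)))
    (+ᴿ-cong {re z *ᴿ im w} {re z′ *ᴿ im w′} {im z *ᴿ re w} {im z′ *ᴿ re w′}
      (*ᴿ-cong {re z} {re z′} {im w} {im w′} p s) (*ᴿ-cong {im z} {im z′} {re w} {re w′} q r))

  +ᶜ-cong : ∀ {z z′ w w′} → z ≈ᶜ z′ → w ≈ᶜ w′ → z +ᶜ w ≈ᶜ z′ +ᶜ w′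
  +ᶜ-cong {z} {z′} {w} {w′} (mk≈ᶜ p q) (mk≈ᶜ r s) = mk≈ᶜ
    (+ᴿ-cong {re z} {re z′} {re w} {re w′} p r)
    (+ᴿ-cong {im z} {im z′} {im w} {im w′} q s)

  *ᶜ-comm : ∀ z w → z *ᶜ w ≈ᶜ w *ᶜ z
  *ᶜ-comm z w = pointwiseᶜ
      (λ n → +-*-Solver.solve 4 (λ a b c d → a :* c :- b :* d := c :* a :- d :* b)
        refl (seq (re z) n) (seq (im z) n) (seq (re w) n) (seq (im w) n))
      (λ n → +-*-Solver.solve 4 (λ a b c d → a :* d :+ b :* c := c :* b :+ d :* a)
        refl (seq (re z) n) (seq (im z) n) (seq (re w) n) (seq (im w) n))
    where open +-*-Solver using (_:+_; _:*_; _:-_; _:=_)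

  *ᶜ-assoc : ∀ u v w → (u *ᶜ v) *ᶜ w ≈ᶜ u *ᶜ (v *ᶜ w)
  *ᶜ-assoc u v w = pointwiseᶜ
      (λ n → +-*-Solver.solve 6 (λ a b c d e f →
        (a :* c :- b :* d) :* e :- (a :* d :+ b :* c) :* f
          := a :* (c :* e :- d :* f) :- b :* (c :* f :+ d :* e))
        refl (seq (re u) n) (seq (im u) n) (seq (re v) n) (seq (im v) n) (seq (re w) n) (seq (im w) n))
      (λ n → +-*-Solver.solve 6 (λ a b c d e f →
        (a :* c :- b :* d) :* f :+ (a :* d :+ b :* c) :* e
          := a :* (c :* f :+ d :* e) :+ b :* (c :* e :- d :* f))
        refl (seq (re u) n) (seq (im u) n) (seq (re v) n) (seq (im v) n) (seq (re w) n) (seq (im w) n))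
    where open +-*-Solver using (_:+_; _:*_; _:-_; _:=_)

  *ᶜ-identityˡ : ∀ z → 1ᶜ *ᶜ z ≈ᶜ z
  *ᶜ-identityˡ z = pointwiseᶜ
      (λ n → +-*-Solver.solve 2 (λ a b → con 1ℚ :* a :- con 0ℚ :* b := a)
        refl (seq (re z) n) (seq (im z) n))
      (λ n → +-*-Solver.solve 2 (λ a b → con 1ℚ :* b :+ con 0ℚ :* a := b)
        refl (seq (re z) n) (seq (im z) n))
    where open +-*-Solver using (_:+_; _:*_; _:-_; _:=_; con)

  *ᶜ-distribˡ : ∀ u v w → u *ᶜ (v +ᶜ w) ≈ᶜ u *ᶜ v +ᶜ u *ᶜ w
  *ᶜ-distribˡ u v w = pointwiseᶜ
      (λ n → +-*-Solver.solve 6 (λ a b c d e f →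
        a :* (c :+ e) :- b :* (d :+ f) := (a :* c :- b :* d) :+ (a :* e :- b :* f))
        refl (seq (re u) n) (seq (im u) n) (seq (re v) n) (seq (im v) n) (seq (re w) n) (seq (im w) n))
      (λ n → +-*-Solver.solve 6 (λ a b c d e f →
        a :* (d :+ f) :+ b :* (c :+ e) := (a :* d :+ b :* c) :+ (a :* f :+ b :* e))
        refl (seq (re u) n) (seq (im u) n) (seq (re v) n) (seq (im v) n) (seq (re w) n) (seq (im w) n))
    where open +-*-Solver using (_:+_; _:*_; _:-_; _:=_)

  module ≈ᶜ = IsEquivalence ≈ᶜ-isEquivalence

  *ᶜ-identityʳ : ∀ z → z *ᶜ 1ᶜ ≈ᶜ z
  *ᶜ-identityʳ z = ≈ᶜ.trans (*ᶜ-comm z 1ᶜ) (*ᶜ-identityˡ z)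

  *ᶜ-distribʳ : ∀ u v w → (v +ᶜ w) *ᶜ u ≈ᶜ v *ᶜ u +ᶜ w *ᶜ u
  *ᶜ-distribʳ u v w = ≈ᶜ.trans (*ᶜ-comm (v +ᶜ w) u)
    (≈ᶜ.trans (*ᶜ-distribˡ u v w) (+ᶜ-cong (*ᶜ-comm u v) (*ᶜ-comm u w)))

  +ᶜ-assoc : ∀ u v w → (u +ᶜ v) +ᶜ w ≈ᶜ u +ᶜ (v +ᶜ w)
  +ᶜ-assoc u v w = pointwiseᶜ
    (λ n → ℚ.+-assoc (seq (re u) n) (seq (re v) n) (seq (re w) n))
    (λ n → ℚ.+-assoc (seq (im u) n) (seq (im v) n) (seq (im w) n))

  +ᶜ-comm : ∀ z w → z +ᶜ w ≈ᶜ w +ᶜ z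
  +ᶜ-comm z w = pointwiseᶜ
    (λ n → ℚ.+-comm (seq (re z) n) (seq (re w) n)) (λ n → ℚ.+-comm (seq (im z) n) (seq (im w) n))

  +ᶜ-identityˡ : ∀ z → 0ᶜ +ᶜ z ≈ᶜ z
  +ᶜ-identityˡ z = pointwiseᶜ
    (λ n → ℚ.+-identityˡ (seq (re z) n)) (λ n → ℚ.+-identityˡ (seq (im z) n))

  -ᶜ-inverseˡ : ∀ z → (-ᶜ z) +ᶜ z ≈ᶜ 0ᶜ
  -ᶜ-inverseˡ z = pointwiseᶜ
    (λ n → ℚ.+-inverseˡ (seq (re z) n)) (λ n → ℚ.+-inverseˡ (seq (im z) n))

  -ᶜ-cong : ∀ {z w} → z ≈ᶜ w → -ᶜ z ≈ᶜ -ᶜ w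
  -ᶜ-cong {z} {w} (mk≈ᶜ p q) = mk≈ᶜ (-ᴿ-cong {re z} {re w} p) (-ᴿ-cong {im z} {im w} q)

+-*-isCommutativeRingᶜ : IsCommutativeRing _≈ᶜ_ _+ᶜ_ _*ᶜ_ -ᶜ_ 0ᶜ 1ᶜ
+-*-isCommutativeRingᶜ = record
  { isRing = record
    { +-isAbelianGroup = record
      { isGroup = record
        { isMonoid = record
          { isSemigroup = record
            { isMagma = record { isEquivalence = ≈ᶜ-isEquivalence ; ∙-cong = +ᶜ-cong }
            ; assoc   = +ᶜ-assoc
            }
          ; identity = +ᶜ-identityˡ , λ z → ≈ᶜ.trans (+ᶜ-comm z 0ᶜ) (+ᶜ-identityˡ z)
          }
        ; inverse = -ᶜ-inverseˡ , λ z → ≈ᶜ.trans (+ᶜ-comm z (-ᶜ z)) (-ᶜ-inverseˡ z)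
        ; ⁻¹-cong = -ᶜ-cong
        }
      ; comm = +ᶜ-comm
      }
    ; *-cong     = *ᶜ-cong
    ; *-assoc    = *ᶜ-assoc
    ; *-identity = *ᶜ-identityˡ , *ᶜ-identityʳ
    ; distrib    = *ᶜ-distribˡ , *ᶜ-distribʳ
    }
  ; *-comm = *ᶜ-comm
  }

private
  square-nonNeg : ∀ {p} → 0ℚ ≤ p → 0ℚ ≤ p ℚ.* p
  square-nonNeg {p} p≥0 =
    ℚ.nonNegative⁻¹ _ {{ℚ.nonNeg*nonNeg⇒nonNeg p {{ℚ.nonNegative p≥0}} p {{ℚ.nonNegative p≥0}}}}

  0≤p*p : ∀ p → 0ℚ ≤ p ℚ.* p
  0≤p*p p with ℚ.∣p∣≡p∨∣p∣≡-p p
  ... | inj₁ eq = subst (0ℚ ≤_) (cong₂ ℚ._*_ eq eq) (square-nonNeg (ℚ.0≤∣p∣ p))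
  ... | inj₂ eq = subst (0ℚ ≤_) (trans (cong₂ ℚ._*_ eq eq)
      (+-*-Solver.solve 1 (λ a → (:- a) :* (:- a) := a :* a) refl p)) (square-nonNeg (ℚ.0≤∣p∣ p))
    where open +-*-Solver using (_:*_; :-_; _:=_)

  ∣p∣²≤p²+q² : ∀ p q → ∣ p ∣ ℚ.* ∣ p ∣ ≤ ∣ p ℚ.* p ℚ.+ q ℚ.* q ∣
  ∣p∣²≤p²+q² p q = begin
    ∣ p ∣ ℚ.* ∣ p ∣               ≡⟨ ℚ.∣p*q∣≡∣p∣*∣q∣ p p ⟨
    ∣ p ℚ.* p ∣                   ≡⟨ ℚ.0≤p⇒∣p∣≡p (0≤p*p p) ⟩
    p ℚ.* p                       ≡⟨ ℚ.+-identityʳ _ ⟨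
    p ℚ.* p ℚ.+ 0ℚ                ≤⟨ ℚ.+-monoʳ-≤ (p ℚ.* p) (0≤p*p q) ⟩
    p ℚ.* p ℚ.+ q ℚ.* q           ≡⟨ ℚ.0≤p⇒∣p∣≡p (ℚ.+-mono-≤ (0≤p*p p) (0≤p*p q)) ⟨
    ∣ p ℚ.* p ℚ.+ q ℚ.* q ∣       ∎
    where open ℚ.≤-Reasoning

  sum-of-squares-#0 : ∀ x y → x #ᴿ 0ᴿ → x *ᴿ x +ᴿ y *ᴿ y #ᴿ 0ᴿ
  sum-of-squares-#0 x y (ε , ε>0 , far) = ε ℚ.* ε , *-pos ε>0 ε>0 , (far thus λ n p →
    let ε≤∣x∣ = subst (λ r → ε ≤ ∣ r ∣) (p-0≡p (seq x n)) p in
    ℚ.≤-trans (*-mono-≤ (ℚ.<⇒≤ ε>0) (ℚ.0≤∣p∣ (seq x n)) ε≤∣x∣ ε≤∣x∣)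
      (subst (λ r → ∣ seq x n ∣ ℚ.* ∣ seq x n ∣ ≤ ∣ r ∣) (sym (p-0≡p _))
        (∣p∣²≤p²+q² (seq x n) (seq y n))))

  norm² : ℂ → ℝ
  norm² z = re z *ᴿ re z +ᴿ im z *ᴿ im z

  norm²-#0 : ∀ z → z #ᶜ 0ᶜ → norm² z #ᴿ 0ᴿ
  norm²-#0 z (re-# re#0) = sum-of-squares-#0 (re z) (im z) re#0
  norm²-#0 z (im-# im#0) = #ᴿ-resp-≈0 {im z *ᴿ im z +ᴿ re z *ᴿ re z} {norm² z}
    (pointwise⇒≈ {im z *ᴿ im z +ᴿ re z *ᴿ re z} {norm² z}
      λ n → ℚ.+-comm (seq (im z *ᴿ im z) n) (seq (re z *ᴿ re z) n))
    (sum-of-squares-#0 (im z) (re z) im#0)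

recipᶜ : (z : ℂ) → z #ᶜ 0ᶜ → ℂ
re (recipᶜ z z#0) = re z *ᴿ recipᴿ (norm² z) (norm²-#0 z z#0)
im (recipᶜ z z#0) = -ᴿ (im z *ᴿ recipᴿ (norm² z) (norm²-#0 z z#0))

private
  recipᶜ-inverseʳ : ∀ z z#0 → z *ᶜ recipᶜ z z#0 ≈ᶜ 1ᶜ
  recipᶜ-inverseʳ z z#0 = mk≈ᶜ
    (≈ᴿ-trans {re (z *ᶜ recipᶜ z z#0)} {norm² z *ᴿ r} {1ᴿ}
      (pointwise⇒≈ {re (z *ᶜ recipᶜ z z#0)} {norm² z *ᴿ r} λ n →
        real-part (seq (re z) n) (seq (im z) n) (seq r n))
      (recipᴿ-inverse (norm² z) (norm²-#0 z z#0)))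
    (pointwise⇒≈ {im (z *ᶜ recipᶜ z z#0)} {0ᴿ} λ n →
      imaginary-part (seq (re z) n) (seq (im z) n) (seq r n))
    where
    open +-*-Solver using (_:+_; _:*_; _:-_; :-_; _:=_; con)
    r = recipᴿ (norm² z) (norm²-#0 z z#0)
    real-part : ∀ a b r → a ℚ.* (a ℚ.* r) ℚ.+ (ℚ.- (b ℚ.* (ℚ.- (b ℚ.* r)))) ≡ (a ℚ.* a ℚ.+ b ℚ.* b) ℚ.* r
    real-part = +-*-Solver.solve 3
      (λ a b r → a :* (a :* r) :+ (:- (b :* (:- (b :* r)))) := (a :* a :+ b :* b) :* r) refl
    imaginary-part : ∀ a b r → a ℚ.* (ℚ.- (b ℚ.* r)) ℚ.+ b ℚ.* (a ℚ.* r) ≡ 0ℚ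
    imaginary-part = +-*-Solver.solve 3
      (λ a b r → a :* (:- (b :* r)) :+ b :* (a :* r) := con 0ℚ) refl

  1#ᴿ0 : 1ᴿ #ᴿ 0ᴿ
  1#ᴿ0 = 1ℚ , 0<1 , always λ _ → ℚ.≤-refl

  inverse⇒#0 : ∀ z w → z *ᶜ w ≈ᶜ 1ᶜ → z #ᶜ 0ᶜ
  inverse⇒#0 z w (mk≈ᶜ p _) =
    [ re-# ∘ *ᴿ-#0⇒ (re z) (re w)
    , (λ bd#0 → im-# (*ᴿ-#0⇒ (im z) (-ᴿ im w)
        (#ᴿ-resp-≈0 { -ᴿ (im z *ᴿ im w)} {im z *ᴿ (-ᴿ im w)}
          (pointwise⇒≈ { -ᴿ (im z *ᴿ im w)} {im z *ᴿ (-ᴿ im w)} λ n →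
            ℚ.neg-distribʳ-* (seq (im z) n) (seq (im w) n)) bd#0)))
    ]′ (+ᴿ-#0⇒ (re z *ᴿ re w) (-ᴿ (im z *ᴿ im w))
         (#ᴿ-resp-≈0 {1ᴿ} {re (z *ᶜ w)} (≈ᴿ-sym {re (z *ᶜ w)} {1ᴿ} p) 1#ᴿ0))

  #ᴿ⇒-#0 : ∀ {x y} → x #ᴿ y → x -ᴿ y #ᴿ 0ᴿ
  #ᴿ⇒-#0 (ε , ε>0 , far) = ε , ε>0 , (far thus λ n → subst (λ r → ε ≤ ∣ r ∣) (sym (p-0≡p _)))

  -#0⇒#ᴿ : ∀ {x y} → x -ᴿ y #ᴿ 0ᴿ → x #ᴿ y
  -#0⇒#ᴿ (ε , ε>0 , far) = ε , ε>0 , (far thus λ n → subst (λ r → ε ≤ ∣ r ∣) (p-0≡p _))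

  #ᶜ⇒-#0 : ∀ {z w} → z #ᶜ w → z -ᶜ w #ᶜ 0ᶜ
  #ᶜ⇒-#0 {z} {w} (re-# p) = re-# (#ᴿ⇒-#0 {re z} {re w} p)
  #ᶜ⇒-#0 {z} {w} (im-# p) = im-# (#ᴿ⇒-#0 {im z} {im w} p)

  -#0⇒#ᶜ : ∀ {z w} → z -ᶜ w #ᶜ 0ᶜ → z #ᶜ w
  -#0⇒#ᶜ {z} {w} (re-# p) = re-# (-#0⇒#ᴿ {re z} {re w} p)
  -#0⇒#ᶜ {z} {w} (im-# p) = im-# (-#0⇒#ᴿ {im z} {im w} p)

  #ᶜ-cotrans : ∀ {z w} → z #ᶜ w → ∀ v → z #ᶜ v ⊎ v #ᶜ w
  #ᶜ-cotrans {z} {w} (re-# p) v =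
    [ inj₁ ∘ re-# , inj₂ ∘ re-# ]′ (#ᴿ-cotrans {re z} {re w} p (re v))
  #ᶜ-cotrans {z} {w} (im-# p) v =
    [ inj₁ ∘ im-# , inj₂ ∘ im-# ]′ (#ᴿ-cotrans {im z} {im w} p (im v))

  #ᶜ-irrefl : ∀ {z w} → z ≈ᶜ w → ¬ z #ᶜ w
  #ᶜ-irrefl {z} {w} (mk≈ᶜ p q) (re-# r) = #ᴿ-irrefl {re z} {re w} p r
  #ᶜ-irrefl {z} {w} (mk≈ᶜ p q) (im-# r) = #ᴿ-irrefl {im z} {im w} q r

  #ᶜ-sym : ∀ {z w} → z #ᶜ w → w #ᶜ z
  #ᶜ-sym {z} {w} (re-# p) = re-# (#ᴿ-sym {re z} {re w} p)
  #ᶜ-sym {z} {w} (im-# p) = im-# (#ᴿ-sym {im z} {im w} p)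

-- Only the laws of ℂ matter below; without abstract, conversion checking would
-- unfold the underlying Cauchy sequences.
abstract
  isHeytingFieldᶜ : IsHeytingField _≈ᶜ_ _#ᶜ_ _+ᶜ_ _*ᶜ_ -ᶜ_ 0ᶜ 1ᶜ
  isHeytingFieldᶜ = record
    { isHeytingCommutativeRing = record
      { isCommutativeRing = +-*-isCommutativeRingᶜ
      ; isApartnessRelation = record
        { irrefl = #ᶜ-irrefl ; sym = #ᶜ-sym ; cotrans = #ᶜ-cotrans }
      ; #⇒invertible = λ {z} {w} z#w →
          let d = z -ᶜ w ; d#0 = #ᶜ⇒-#0 {z} {w} z#w ; inv = recipᶜ-inverseʳ d d#0 in
          recipᶜ d d#0 , ≈ᶜ.trans (*ᶜ-comm (recipᶜ d d#0) d) inv , inv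
      ; invertible⇒# = λ {z} {w} (v , _ , p) → -#0⇒#ᶜ {z} {w} (inverse⇒#0 (z -ᶜ w) v p)
      }
    ; tight = λ z w →
        (λ ¬z#w → mk≈ᶜ (¬#ᴿ⇒≈ (re z) (re w) (¬z#w ∘ re-#)) (¬#ᴿ⇒≈ (im z) (im w) (¬z#w ∘ im-#)))
      , #ᶜ-irrefl
    }

ℂ-heytingField : HeytingField 0ℓ 0ℓ 0ℓ
ℂ-heytingField = record { isHeytingField = isHeytingFieldᶜ }

underlyingRing : ∀ {c ℓ₁ ℓ₂} → HeytingField c ℓ₁ ℓ₂ → CommutativeRing c ℓ₁
underlyingRing K =
  HeytingCommutativeRing.commutativeRing (HeytingField.heytingCommutativeRing K)

module _ {c ℓ₁ ℓ₂} (K : HeytingField c ℓ₁ ℓ₂) where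
  open HeytingField K using (_#_; 0#; 1#)
  open CommutativeRing (underlyingRing K) using (+-rawMonoid)
  open RawMonoidDefinitions +-rawMonoid using () renaming (_×_ to _⋅_)

  CharacteristicZero : Set ℓ₂
  CharacteristicZero = ∀ n → .{{ℕ.NonZero n}} → n ⋅ 1# # 0#

private
  open CommutativeRing (underlyingRing ℂ-heytingField)
    using () renaming (+-rawMonoid to +-rawMonoidᶜ)
  open RawMonoidDefinitions +-rawMonoidᶜ using () renaming (_×_ to _⋅ᶜ_)

  0≤n⋅1 : ∀ n k → 0ℚ ≤ seq (re (n ⋅ᶜ 1ᶜ)) k
  0≤n⋅1 zero    k = ℚ.≤-refl
  0≤n⋅1 (suc n) k = ℚ.+-mono-≤ (ℚ.<⇒≤ 0<1) (0≤n⋅1 n k)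

abstract
  ℂ-characteristicZero : CharacteristicZero ℂ-heytingField
  ℂ-characteristicZero (suc n) = re-# (1ℚ , 0<1 , always λ k →
    1≤∣1+p-0∣ (seq (re (n ⋅ᶜ 1ᶜ)) k) (0≤n⋅1 n k))
    where
    1≤∣1+p-0∣ : ∀ p → 0ℚ ≤ p → 1ℚ ≤ ∣ 1ℚ ℚ.+ p ℚ.- 0ℚ ∣
    1≤∣1+p-0∣ p p≥0 = begin
      1ℚ                    ≡⟨ ℚ.+-identityʳ 1ℚ ⟨
      1ℚ ℚ.+ 0ℚ             ≤⟨ ℚ.+-monoʳ-≤ 1ℚ p≥0 ⟩
      1ℚ ℚ.+ p              ≡⟨ ℚ.0≤p⇒∣p∣≡p (ℚ.+-mono-≤ (ℚ.<⇒≤ 0<1) p≥0) ⟨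
      ∣ 1ℚ ℚ.+ p ∣          ≡⟨ cong ∣_∣ (p-0≡p (1ℚ ℚ.+ p)) ⟨
      ∣ 1ℚ ℚ.+ p ℚ.- 0ℚ ∣   ∎
      where open ℚ.≤-Reasoning

module PowerSeries {c ℓ₁ ℓ₂} (K : HeytingField c ℓ₁ ℓ₂) (char0 : CharacteristicZero K) where

  private module K = HeytingField K
  open CommutativeRing (underlyingRing K)
    renaming (refl to ≈-refl; sym to ≈-sym; trans to ≈-trans)
  open K using (_#_; #⇒invertible)
  open HCRProperties K.heytingCommutativeRing
    using (x-0≈x; invertibleˡ⇒#; x#0y#0→xy#0; #-congʳ)
  open RawSemiringDefinitions (Semiring.rawSemiring semiring) using (_^_) renaming (_×_ to _⋅_)
  open SumProperties +-commutativeMonoid using (sum; sum-syntax; sum⁺-syntax; sum-cong-≗)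
  open RingProperties ring using (-‿distribʳ-*)

  inverse : ∀ {x} → x # 0# → Carrier
  inverse x#0 = proj₁ (#⇒invertible x#0)

  inverseʳ : ∀ {x} (x#0 : x # 0#) → x * inverse x#0 ≈ 1#
  inverseʳ {x} x#0 =
    ≈-trans (*-congʳ (≈-sym (x-0≈x x))) (proj₂ (proj₂ (#⇒invertible x#0)))

  inverse-#0 : ∀ {x} (x#0 : x # 0#) → inverse x#0 # 0#
  inverse-#0 {x} x#0 =
    invertibleˡ⇒# (x , ≈-trans (*-congˡ (x-0≈x (inverse x#0))) (inverseʳ x#0))

  1/[1+_] : ℕ → Carrier
  1/[1+ n ] = inverse (char0 (suc n))

  1/[_!] : ℕ → Carrier
  1/[ n !] = inverse (char0 (n !) {{n ℕ.!≢0}})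

  Series : Set c
  Series = ℕ → Carrier

  infix 4 _≋_
  _≋_ : Series → Series → Set ℓ₁
  f ≋ g = ∀ n → f n ≈ g n

  1ₛ X : Series
  1ₛ zero    = 1#
  1ₛ (suc n) = 0#
  X zero          = 0#
  X (suc zero)    = 1#
  X (suc (suc n)) = 0#

  infixl 6 _-ₛ_
  _-ₛ_ : Series → Series → Series
  (f -ₛ g) n = f n - g n

  infixl 7 _·_
  _·_ : Series → Series → Series
  (f · g) n = ∑[ i ≤ n ] (f (toℕ i) * g (n ℕ.∸ toℕ i))

  infixr 8 _^ₛ_
  _^ₛ_ : Series → ℕ → Series
  f ^ₛ zero  = 1ₛ
  f ^ₛ suc k = f · f ^ₛ k

  infix 9 _′
  _′ : Series → Series
  (f ′) n = suc n ⋅ f (suc n)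

  -- Substitution f(g(x)).  It is only meaningful when g has zero constant
  -- term: then g ^ k contributes nothing to the coefficient of xⁿ for k > n,
  -- so truncating the sum at k = n is exact.
  infixr 9 _⋄_
  _⋄_ : Series → Series → Series
  (f ⋄ g) n = ∑[ k ≤ n ] (f (toℕ k) * (g ^ₛ toℕ k) n)

  record IsCompositionalInverse (f g : Series) : Set ℓ₁ where
    field
      constant-term : g 0 ≈ 0#
      right-inverse : f ⋄ g ≋ X

  egf : (ℕ → Carrier) → Series
  egf a n = a n * 1/[ n !]

  exp : Series
  exp = egf λ _ → 1#

  ln1+x : Series
  ln1+x zero    = 0#
  ln1+x (suc k) = (- 1#) ^ k * 1/[1+ k ]

  -- Only meaningful for series with constant term 1.
  ln : Series → Series
  ln f = ln1+x ⋄ (f -ₛ 1ₛ)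

  module _ (f : Series) (f₀#0 : f 0 # 0#) where

    -- The first n + 1 coefficients of 1 / f, highest degree first.
    private
      coefficients : ∀ n → Vec Carrier (suc n)
      coefficients zero    = inverse f₀#0 ∷ []
      coefficients (suc n) =
        - (inverse f₀#0 * ∑[ i ≤ n ] (f (suc (toℕ i)) * lookup (coefficients n) i))
          ∷ coefficients n

    reciprocal : Series
    reciprocal n = head (coefficients n)

    private
      lookup-coefficients : ∀ n (i : Fin (suc n)) →
        lookup (coefficients n) i ≡ reciprocal (n ℕ.∸ toℕ i)
      lookup-coefficients zero    Fin.zero    = refl
      lookup-coefficients (suc n) Fin.zero    = refl
      lookup-coefficients (suc n) (Fin.suc i) = lookup-coefficients n i

    reciprocal-inverseʳ : f · reciprocal ≋ 1ₛ
    reciprocal-inverseʳ zero = ≈-trans (+-identityʳ _) (inverseʳ f₀#0)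
    reciprocal-inverseʳ (suc n) = begin
      f 0 * (- (inverse f₀#0 * S)) + T    ≈⟨ +-congʳ (-‿distribʳ-* (f 0) (inverse f₀#0 * S)) ⟨
      - (f 0 * (inverse f₀#0 * S)) + T    ≈⟨ +-congʳ (-‿cong (*-assoc (f 0) (inverse f₀#0) S)) ⟨
      - (f 0 * inverse f₀#0 * S) + T      ≈⟨ +-congʳ (-‿cong (*-congʳ (inverseʳ f₀#0))) ⟩
      - (1# * S) + T                      ≈⟨ +-congʳ (-‿cong (*-identityˡ S)) ⟩
      - S + T                             ≈⟨ +-congˡ (reflexive S≡T) ⟨
      - S + S                             ≈⟨ -‿inverseˡ S ⟩
      0#                                  ∎
      where
      open SetoidReasoning setoid
      S = ∑[ i ≤ n ] (f (suc (toℕ i)) * lookup (coefficients n) i)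
      T = ∑[ i ≤ n ] (f (suc (toℕ i)) * reciprocal (n ℕ.∸ toℕ i))
      S≡T : S ≡ T
      S≡T = sum-cong-≗ λ i → cong (f (suc (toℕ i)) *_) (lookup-coefficients n i)

  egf′-#0 : ∀ a → a 1 # 0# → (egf a ′) 0 # 0#
  egf′-#0 a a₁#0 = #-congʳ (≈-sym (+-identityʳ (egf a 1)))
    (x#0y#0→xy#0 a₁#0 (inverse-#0 (char0 (1 !))))

open PowerSeries ℂ-heytingField ℂ-characteristicZero public

module Submission where

-- Write g for the compositional inverse of f and D for the operator (1/f′) d/dx.
--
-- Differentiating f(g(x)) = x gives f′(g) g′ = 1, that is g′ = (1/f′)(g).  The
-- chain rule then reads (h(g))′ = (D h)(g) for every series h (⋄-inverse′):
-- substituting g turns D into ordinary differentiation.  Iterating, the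
-- constant term of Dᵐ h is the m-th derivative of h(g) at 0 (iterate-D), so
-- by Taylor's formula the exponential generating function of the numbers
-- (Dᵐ h)(0) is h(g) (egf-iterate-D).  For h = exp the series under the
-- logarithm is therefore e = exp(g).
--
-- It remains to see that ln (exp(g)) = g.  From exp′ = exp and the chain rule,
-- e′ = e g′.  As the derivative of ln(1+x) is 1/(1+x), it follows that
-- (ln e)′ = e′/e = g′; the constant terms of ln e and of g both vanish, and in
-- characteristic zero a series is determined by its derivative and its constant
-- term (ln-unique).
--
-- Two facts about substitution carry this: h ↦ h(g) is multiplicative (⋄-·) and
-- obeys the chain rule (chain-rule).  Writing h = h₀ + x h₁(x), substitution
-- satisfies h(g) = h₀ + g h₁(g) (⋄-tail).  In each of the two facts both sides,
-- as functions of h, satisfy one and the same recursion of this shape, and such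
-- a recursion has only one solution because g has no constant term
-- (recursion-unique).
--
-- Everything holds over an arbitrary Heyting field of characteristic zero.

open import Algebra.Apartness.Bundles using (HeytingField)
open import Algebra.Bundles using (CommutativeRing; CommutativeSemiring; Semiring)
import Algebra.Definitions.RawSemiring as RawSemiringDefinitions
import Algebra.Properties.CommutativeMonoid.Mult as MultProperties
import Algebra.Properties.Ring as RingProperties
import Algebra.Properties.Semiring.Mult as SemiringMultProperties
import Algebra.Properties.Semiring.Sum as SumProperties
import Algebra.Solver.Ring.NaturalCoefficients.Default as SemiringSolver
open import Algebra.Structures.Biased using (IsCommutativeSemiringˡ; isCommutativeSemiringˡ)
open import Data.Fin.Base using (toℕ)
open import Data.Nat.Base as ℕ using (ℕ; zero; suc; z≤n; s≤s; _!)
open import Data.Nat.GeneralisedArithmetic using (iterate)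
import Data.Nat.Properties as ℕ
open import Data.Product.Base using (_,_)
open import Function.Base using (_∘_)
import Relation.Binary.Reasoning.Setoid as SetoidReasoning
open import Relation.Binary.Structures using (IsEquivalence)

open import Defs using (CharacteristicZero; underlyingRing; module PowerSeries)

module _ {c ℓ₁ ℓ₂} (K : HeytingField c ℓ₁ ℓ₂) (char0 : CharacteristicZero K) where

  open CommutativeRing (underlyingRing K)
  open MultProperties +-commutativeMonoid using (×-congʳ; ×-congˡ; ×-assocˡ; ×-distrib-+)
    renaming (_×_ to _⋅_)
  open SemiringMultProperties semiring using (×-comm-*; ×-assoc-*)
  open SumProperties semiring
    using (sum-syntax; sum⁺-syntax; sum-cong-≋; sum-replicate-zero; ∑-distrib-+; *-distribˡ-sum)
  open RingProperties ring using (-1*x≈-x)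
  open PowerSeries K char0
  open RawSemiringDefinitions (Semiring.rawSemiring semiring) using (_^_)
  open SemiringSolver commutativeSemiring using (solve; _:+_; _:*_; _:=_)
  open SetoidReasoning setoid

  -- The commutative semiring of power series

  infixl 6 _+ₛ_
  _+ₛ_ : Series → Series → Series
  (f +ₛ g) n = f n + g n

  0ₛ : Series
  0ₛ n = 0#

  -- The quotient (f(x) - f(0)) / x.
  tail : Series → Series
  tail f n = f (suc n)

  -- The series a + x f(x).
  infixr 5 _∷_
  _∷_ : Carrier → Series → Series
  (a ∷ f) zero    = a
  (a ∷ f) (suc n) = f n

  constant : Carrier → Series
  constant a = a ∷ 0ₛ

  ≋-isEquivalence : IsEquivalence _≋_
  ≋-isEquivalence = record
    { refl  = λ n → refl
    ; sym   = λ p n → sym (p n)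
    ; trans = λ p q n → trans (p n) (q n)
    }

  -- The coefficient of xⁿ in a product depends only on the coefficients of the
  -- factors up to xⁿ.
  ·-local : ∀ n {f f₁ g g₁} → (∀ k → k ℕ.≤ n → f k ≈ f₁ k) → (∀ k → k ℕ.≤ n → g k ≈ g₁ k) →
            (f · g) n ≈ (f₁ · g₁) n
  ·-local zero    p q = +-congʳ (*-cong (p 0 z≤n) (q 0 z≤n))
  ·-local (suc n) p q = +-cong (*-cong (p 0 z≤n) (q (suc n) ℕ.≤-refl))
    (·-local n (λ k k≤n → p (suc k) (s≤s k≤n)) (λ k k≤n → q k (ℕ.m≤n⇒m≤1+n k≤n)))

  ·-localʳ : ∀ n f {g g₁} → (∀ k → k ℕ.≤ n → g k ≈ g₁ k) → (f · g) n ≈ (f · g₁) n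
  ·-localʳ n f = ·-local n {f} {f} (λ _ _ → refl)

  ·-cong : ∀ {f f₁ g g₁} → f ≋ f₁ → g ≋ g₁ → f · g ≋ f₁ · g₁
  ·-cong p q n = ·-local n (λ k _ → p k) (λ k _ → q k)

  ·-zeroˡ : ∀ f → 0ₛ · f ≋ 0ₛ
  ·-zeroˡ f zero    = trans (+-identityʳ _) (zeroˡ _)
  ·-zeroˡ f (suc n) = trans (+-cong (zeroˡ _) (·-zeroˡ f n)) (+-identityʳ _)

  constant-· : ∀ a f n → (constant a · f) n ≈ a * f n
  constant-· a f zero    = +-identityʳ _
  constant-· a f (suc n) = trans (+-congˡ (·-zeroˡ f n)) (+-identityʳ _)

  ·-distribʳ : ∀ h f g → (f +ₛ g) · h ≋ f · h +ₛ g · h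
  ·-distribʳ h f g zero = begin
    (f 0 + g 0) * h 0 + 0#  ≈⟨ +-identityʳ _ ⟩
    (f 0 + g 0) * h 0       ≈⟨ distribʳ _ _ _ ⟩
    f 0 * h 0 + g 0 * h 0   ≈⟨ +-cong (+-identityʳ _) (+-identityʳ _) ⟨
    (f 0 * h 0 + 0#) + (g 0 * h 0 + 0#) ∎
  ·-distribʳ h f g (suc n) = trans (+-cong (distribʳ _ _ _) (·-distribʳ h (tail f) (tail g) n))
    (solve 4 (λ a b c d → (a :+ b) :+ (c :+ d) := (a :+ c) :+ (b :+ d)) refl _ _ _ _)

  *-·-assoc : ∀ a f g n → ((λ k → a * f k) · g) n ≈ a * (f · g) n
  *-·-assoc a f g zero    = begin
    a * f 0 * g 0 + 0#        ≈⟨ +-cong (*-assoc _ _ _) (sym (zeroʳ a)) ⟩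
    a * (f 0 * g 0) + a * 0#  ≈⟨ distribˡ _ _ _ ⟨
    a * (f 0 * g 0 + 0#) ∎
  *-·-assoc a f g (suc n) = begin
    a * f 0 * g (suc n) + ((λ k → a * tail f k) · g) n  ≈⟨ +-cong (*-assoc _ _ _) (*-·-assoc a (tail f) g n) ⟩
    a * (f 0 * g (suc n)) + a * (tail f · g) n          ≈⟨ distribˡ _ _ _ ⟨
    a * (f 0 * g (suc n) + (tail f · g) n) ∎

  ·-comm : ∀ f g → f · g ≋ g · f
  ·-comm f g zero          = +-congʳ (*-comm _ _)
  ·-comm f g (suc zero)    = solve 5 (λ a b c d o → a :* b :+ (c :* d :+ o) := d :* c :+ (b :* a :+ o))
    refl (f 0) (g 1) (f 1) (g 0) 0#
  ·-comm f g (suc (suc n)) = begin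
    f 0 * g (2 ℕ.+ n) + (tail f · g) (suc n)                       ≈⟨ +-congˡ (·-comm (tail f) g (suc n)) ⟩
    f 0 * g (2 ℕ.+ n) + (g 0 * f (2 ℕ.+ n) + (tail g · tail f) n)  ≈⟨ +-congˡ (+-congˡ (·-comm (tail g) (tail f) n)) ⟩
    f 0 * g (2 ℕ.+ n) + (g 0 * f (2 ℕ.+ n) + (tail f · tail g) n)
      ≈⟨ solve 3 (λ a b c → a :+ (b :+ c) := b :+ (a :+ c)) refl _ _ _ ⟩
    g 0 * f (2 ℕ.+ n) + (f · tail g) (suc n)  ≈⟨ +-congˡ (·-comm f (tail g) (suc n)) ⟩
    g 0 * f (2 ℕ.+ n) + (tail g · f) (suc n) ∎

  ·-assoc : ∀ f g h → (f · g) · h ≋ f · (g · h)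
  ·-assoc f g h zero = +-congʳ (begin
    (f 0 * g 0 + 0#) * h 0  ≈⟨ *-congʳ (+-identityʳ _) ⟩
    f 0 * g 0 * h 0         ≈⟨ *-assoc _ _ _ ⟩
    f 0 * (g 0 * h 0)       ≈⟨ *-congˡ (+-identityʳ _) ⟨
    f 0 * (g 0 * h 0 + 0#)  ∎)
  ·-assoc f g h (suc n) = begin
    (f · g) 0 * h (suc n) + (((λ k → f 0 * tail g k) +ₛ tail f · g) · h) n
      ≈⟨ +-cong (*-congʳ (+-identityʳ _)) (·-distribʳ h (λ k → f 0 * tail g k) (tail f · g) n) ⟩
    f 0 * g 0 * h (suc n) + (((λ k → f 0 * tail g k) · h) n + ((tail f · g) · h) n)
      ≈⟨ +-congˡ (+-cong (*-·-assoc (f 0) (tail g) h n) (·-assoc (tail f) g h n)) ⟩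
    f 0 * g 0 * h (suc n) + (f 0 * (tail g · h) n + (tail f · (g · h)) n)
      ≈⟨ solve 5 (λ a b c d e → a :* b :* c :+ (a :* d :+ e) := a :* (b :* c :+ d) :+ e) refl _ _ _ _ _ ⟩
    f 0 * (g · h) (suc n) + (tail f · (g · h)) n ∎

  ·-identityˡ : ∀ f → 1ₛ · f ≋ f
  ·-identityˡ f zero    = trans (+-identityʳ _) (*-identityˡ _)
  ·-identityˡ f (suc n) = trans (+-cong (*-identityˡ _) (·-zeroˡ f n)) (+-identityʳ _)

  series-commutativeSemiring : CommutativeSemiring c ℓ₁
  series-commutativeSemiring = record
    { isCommutativeSemiring = isCommutativeSemiringˡ record
      { +-isCommutativeMonoid = record
        { isMonoid = record
          { isSemigroup = record
            { isMagma = record { isEquivalence = ≋-isEquivalence ; ∙-cong = λ p q n → +-cong (p n) (q n) }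
            ; assoc   = λ f g h n → +-assoc _ _ _
            }
          ; identity = (λ f n → +-identityˡ _) , (λ f n → +-identityʳ _)
          }
        ; comm = λ f g n → +-comm _ _
        }
      ; *-isCommutativeMonoid = record
        { isMonoid = record
          { isSemigroup = record
            { isMagma = record { isEquivalence = ≋-isEquivalence ; ∙-cong = ·-cong }
            ; assoc   = ·-assoc
            }
          ; identity = ·-identityˡ , (λ f n → trans (·-comm f 1ₛ n) (·-identityˡ f n))
          }
        ; comm = ·-comm
        }
      ; distribʳ = ·-distribʳ
      ; zeroˡ    = ·-zeroˡ
      }
    }

  private module S where
    open CommutativeSemiring series-commutativeSemiring public
    open SetoidReasoning (CommutativeSemiring.setoid series-commutativeSemiring) public

  open SemiringSolver series-commutativeSemiring
    using () renaming (solve to solveₛ; _:+_ to _⊕_; _:*_ to _⊗_; _:=_ to _⊜_)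

  -- Differentiation

  ′-cong : ∀ {f g} → f ≋ g → f ′ ≋ g ′
  ′-cong p n = ×-congʳ (suc n) (p (suc n))

  ′-+ : ∀ f g → (f +ₛ g) ′ ≋ f ′ +ₛ g ′
  ′-+ f g n = ×-distrib-+ (f (suc n)) (g (suc n)) (suc n)

  -- The derivative of f(0) + x (tail f)(x).
  ′-tail : ∀ f → f ′ ≋ tail f +ₛ (0# ∷ tail f ′)
  ′-tail f zero    = refl
  ′-tail f (suc n) = refl

  ′-· : ∀ f g → (f · g) ′ ≋ f ′ · g +ₛ f · g ′
  ′-· f g zero = begin
    f 0 * g 1 + (f 1 * g 0 + 0#) + 0#  ≈⟨ +-identityʳ _ ⟩
    f 0 * g 1 + (f 1 * g 0 + 0#)       ≈⟨ +-congˡ (+-identityʳ _) ⟩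
    f 0 * g 1 + f 1 * g 0              ≈⟨ +-comm _ _ ⟩
    f 1 * g 0 + f 0 * g 1
      ≈⟨ +-cong (*-congʳ (+-identityʳ _)) (*-congˡ (+-identityʳ _)) ⟨
    (f ′) 0 * g 0 + f 0 * (g ′) 0  ≈⟨ +-cong (+-identityʳ _) (+-identityʳ _) ⟨
    (f ′ · g) 0 + (f · g ′) 0 ∎
  ′-· f g (suc n) = begin
    (2 ℕ.+ n) ⋅ (f 0 * g (2 ℕ.+ n) + t (suc n))
      ≈⟨ ×-distrib-+ _ _ (2 ℕ.+ n) ⟩
    (2 ℕ.+ n) ⋅ (f 0 * g (2 ℕ.+ n)) + (t (suc n) + (t ′) n)
      ≈⟨ +-cong (sym (×-comm-* (2 ℕ.+ n) _ _)) (+-congˡ (′-· (tail f) g n)) ⟩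
    f 0 * (g ′) (suc n) + (t (suc n) + ((tail f ′ · g) n + (tail f · g ′) n))
      ≈⟨ solve 4 (λ a b c d → a :+ (b :+ (c :+ d)) := (b :+ c) :+ (a :+ d)) refl _ _ _ _ ⟩
    (t (suc n) + (tail f ′ · g) n) + (f · g ′) (suc n)
      ≈⟨ +-congʳ (+-congˡ (trans (+-congʳ (zeroˡ _)) (+-identityˡ _))) ⟨
    (t +ₛ (0# ∷ tail f ′) · g) (suc n) + (f · g ′) (suc n)
      ≈⟨ +-congʳ (·-distribʳ g (tail f) (0# ∷ tail f ′) (suc n)) ⟨
    ((tail f +ₛ (0# ∷ tail f ′)) · g) (suc n) + (f · g ′) (suc n)
      ≈⟨ +-congʳ (·-cong {g = g} (′-tail f) (λ k → refl) (suc n)) ⟨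
    (f ′ · g) (suc n) + (f · g ′) (suc n) ∎
    where t = tail f · g

  ×-zeroʳ : ∀ n → n ⋅ 0# ≈ 0#
  ×-zeroʳ zero    = refl
  ×-zeroʳ (suc n) = trans (+-identityˡ _) (×-zeroʳ n)

  constant-′ : ∀ a → constant a ′ ≋ 0ₛ
  constant-′ a n = ×-zeroʳ (suc n)

  1ₛ-′ : 1ₛ ′ ≋ 0ₛ
  1ₛ-′ n = ×-zeroʳ (suc n)

  X′ : X ′ ≋ 1ₛ
  X′ zero    = +-identityʳ _
  X′ (suc n) = ×-zeroʳ (2 ℕ.+ n)

  n⋅1*x : ∀ n x → n ⋅ 1# * x ≈ n ⋅ x
  n⋅1*x n x = trans (×-assoc-* n 1# x) (×-congʳ n (*-identityˡ x))

  -- In characteristic zero a series is determined by its constant term and its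
  -- derivative.
  ′-injective : ∀ {f g} → f 0 ≈ g 0 → f ′ ≋ g ′ → f ≋ g
  ′-injective p q zero = p
  ′-injective {f} {g} p q (suc n) = begin
    f (suc n)                        ≈⟨ cancel (f (suc n)) ⟨
    1/[1+ n ] * (suc n ⋅ f (suc n))  ≈⟨ *-congˡ (q n) ⟩
    1/[1+ n ] * (suc n ⋅ g (suc n))  ≈⟨ cancel (g (suc n)) ⟩
    g (suc n) ∎
    where
    cancel : ∀ x → 1/[1+ n ] * (suc n ⋅ x) ≈ x
    cancel x = begin
      1/[1+ n ] * (suc n ⋅ x)       ≈⟨ *-congˡ (n⋅1*x (suc n) x) ⟨
      1/[1+ n ] * (suc n ⋅ 1# * x)  ≈⟨ *-assoc _ _ _ ⟨
      1/[1+ n ] * (suc n ⋅ 1#) * x  ≈⟨ *-congʳ (*-comm _ _) ⟩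
      (suc n ⋅ 1#) * 1/[1+ n ] * x  ≈⟨ *-congʳ (inverseʳ (char0 (suc n))) ⟩
      1# * x                        ≈⟨ *-identityˡ x ⟩
      x ∎

  -- Substitution

  ∑-cong : ∀ n (a b : ℕ → Carrier) → (∀ i → a i ≈ b i) →
           ∑[ i < n ] a (toℕ i) ≈ ∑[ i < n ] b (toℕ i)
  ∑-cong n a b p = sum-cong-≋ {n} (λ i → p (toℕ i))

  ∑-zero : ∀ n (a : ℕ → Carrier) → (∀ i → a i ≈ 0#) → ∑[ i < n ] a (toℕ i) ≈ 0#
  ∑-zero n a a≈0 = trans (∑-cong n a (λ _ → 0#) a≈0) (sum-replicate-zero n)

  ∑-extend : ∀ {m n} (a : ℕ → Carrier) → m ℕ.≤ n → (∀ i → m ℕ.≤ i → a i ≈ 0#) →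
             ∑[ i < m ] a (toℕ i) ≈ ∑[ i < n ] a (toℕ i)
  ∑-extend {n = n} a z≤n       a≈0 = sym (∑-zero n a (λ i → a≈0 i z≤n))
  ∑-extend         a (s≤s m≤n) a≈0 =
    +-congˡ (∑-extend (a ∘ suc) m≤n (λ i m≤i → a≈0 (suc i) (s≤s m≤i)))

  -- Multiplication by h commutes with finite linear combinations of series.
  ·-∑ : ∀ N h (a : ℕ → Carrier) (p : ℕ → Series) n →
        (h · (λ m → ∑[ k < N ] (a (toℕ k) * p (toℕ k) m))) n
          ≈ ∑[ k < N ] (a (toℕ k) * (h · p (toℕ k)) n)
  ·-∑ zero    h a p = S.zeroʳ h
  ·-∑ (suc N) h a p n = begin
    (h · ((λ m → a 0 * p 0 m) +ₛ q)) n       ≈⟨ S.distribˡ h (λ m → a 0 * p 0 m) q n ⟩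
    (h · (λ m → a 0 * p 0 m)) n + (h · q) n  ≈⟨ +-cong scalar (·-∑ N h (a ∘ suc) (p ∘ suc) n) ⟩
    a 0 * (h · p 0) n
      + ∑[ k < N ] (a (suc (toℕ k)) * (h · p (suc (toℕ k))) n) ∎
    where
    q : Series
    q m = ∑[ k < N ] (a (suc (toℕ k)) * p (suc (toℕ k)) m)
    scalar : (h · (λ m → a 0 * p 0 m)) n ≈ a 0 * (h · p 0) n
    scalar = begin
      (h · (λ m → a 0 * p 0 m)) n  ≈⟨ ·-comm h (λ m → a 0 * p 0 m) n ⟩
      ((λ m → a 0 * p 0 m) · h) n  ≈⟨ *-·-assoc (a 0) (p 0) h n ⟩
      a 0 * (p 0 · h) n            ≈⟨ *-congˡ (·-comm (p 0) h n) ⟩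
      a 0 * (h · p 0) n ∎

  ⋄-constant-term : ∀ f g → (f ⋄ g) 0 ≈ f 0
  ⋄-constant-term f g = trans (+-identityʳ _) (*-identityʳ _)

  ⋄-congʳ : ∀ {f₁ f₂} g → f₁ ≋ f₂ → f₁ ⋄ g ≋ f₂ ⋄ g
  ⋄-congʳ {f₁} {f₂} g p n =
    ∑-cong (suc n) (λ k → f₁ k * (g ^ₛ k) n) (λ k → f₂ k * (g ^ₛ k) n) (λ k → *-congʳ (p k))

  ⋄-+ : ∀ f₁ f₂ g → (f₁ +ₛ f₂) ⋄ g ≋ f₁ ⋄ g +ₛ f₂ ⋄ g
  ⋄-+ f₁ f₂ g n = trans
    (∑-cong (suc n) (λ k → (f₁ k + f₂ k) * (g ^ₛ k) n) (λ k → f₁ k * (g ^ₛ k) n + f₂ k * (g ^ₛ k) n)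
      (λ k → distribʳ _ _ _))
    (∑-distrib-+ {suc n} (λ k → f₁ (toℕ k) * (g ^ₛ toℕ k) n) (λ k → f₂ (toℕ k) * (g ^ₛ toℕ k) n))

  *-⋄ : ∀ a f g n → ((λ k → a * f k) ⋄ g) n ≈ a * (f ⋄ g) n
  *-⋄ a f g n = trans
    (∑-cong (suc n) (λ k → a * f k * (g ^ₛ k) n) (λ k → a * (f k * (g ^ₛ k) n)) (λ k → *-assoc _ _ _))
    (sym (*-distribˡ-sum {suc n} a (λ k → f (toℕ k) * (g ^ₛ toℕ k) n)))

  module _ {g : Series} (g₀≈0 : g 0 ≈ 0#) where

    ·-tail : ∀ f n → (g · f) (suc n) ≈ (tail g · f) n
    ·-tail f n = trans (+-congʳ (trans (*-congʳ g₀≈0) (zeroˡ _))) (+-identityˡ _)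

    ·-constant-term : ∀ f → (g · f) 0 ≈ 0#
    ·-constant-term f = trans (+-identityʳ _) (trans (*-congʳ g₀≈0) (zeroˡ _))

    ^-vanish : ∀ k n → n ℕ.< k → (g ^ₛ k) n ≈ 0#
    ^-vanish (suc k) zero    _         = ·-constant-term (g ^ₛ k)
    ^-vanish (suc k) (suc n) (s≤s n<k) = begin
      (g · g ^ₛ k) (suc n)  ≈⟨ ·-tail (g ^ₛ k) n ⟩
      (tail g · g ^ₛ k) n   ≈⟨ ·-localʳ n (tail g) (λ j j≤n → ^-vanish k j (ℕ.≤-<-trans j≤n n<k)) ⟩
      (tail g · 0ₛ) n       ≈⟨ S.zeroʳ (tail g) n ⟩
      0# ∎

    -- The truncation point of the sum defining f ⋄ g varies with the
    -- coefficient; it is first made uniform, so that multiplication by g can be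
    -- taken out of the sum.
    ⋄-tail : ∀ f → f ⋄ g ≋ constant (f 0) +ₛ g · (tail f ⋄ g)
    ⋄-tail f zero    = begin
      (f ⋄ g) 0  ≈⟨ ⋄-constant-term f g ⟩
      f 0        ≈⟨ +-identityʳ _ ⟨
      f 0 + 0#   ≈⟨ +-congˡ (·-constant-term (tail f ⋄ g)) ⟨
      f 0 + (g · (tail f ⋄ g)) 0 ∎
    ⋄-tail f (suc n) = +-cong (zeroʳ _) (begin
      ∑[ k ≤ n ] (tail f (toℕ k) * (g · g ^ₛ toℕ k) (suc n))  ≈⟨ ·-∑ (suc n) g (tail f) (g ^ₛ_) (suc n) ⟨
      (g · truncated) (suc n)                                 ≈⟨ ·-tail truncated n ⟩
      (tail g · truncated) n                                  ≈⟨ ·-localʳ n (tail g) truncation-exact ⟨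
      (tail g · (tail f ⋄ g)) n                               ≈⟨ ·-tail (tail f ⋄ g) n ⟨
      (g · (tail f ⋄ g)) (suc n)    ∎)
      where
      truncated : Series
      truncated m = ∑[ k ≤ n ] (tail f (toℕ k) * (g ^ₛ toℕ k) m)
      truncation-exact : ∀ m → m ℕ.≤ n → (tail f ⋄ g) m ≈ truncated m
      truncation-exact m m≤n = ∑-extend (λ k → tail f k * (g ^ₛ k) m) (s≤s m≤n)
        (λ k m<k → trans (*-congˡ (^-vanish k m m<k)) (zeroʳ _))

    -- The recursion Φ(f) = c(f) + g Φ(tail f) determines Φ: because g has no
    -- constant term, the coefficient of xⁿ in Φ(f) involves only coefficients
    -- of Φ(tail f) of degree less than n.
    recursion-unique : ∀ (c Φ Ψ : Series → Series) →
      (∀ f → Φ f ≋ c f +ₛ g · Φ (tail f)) → (∀ f → Ψ f ≋ c f +ₛ g · Ψ (tail f)) →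
      ∀ f → Φ f ≋ Ψ f
    recursion-unique c Φ Ψ p q f n = go n f n ℕ.≤-refl
      where
      go : ∀ n f k → k ℕ.≤ n → Φ f k ≈ Ψ f k
      step : ∀ n f k → k ℕ.≤ n → (g · Φ (tail f)) k ≈ (g · Ψ (tail f)) k
      go n f k k≤n = trans (p f k) (trans (+-congˡ (step n f k k≤n)) (sym (q f k)))
      step n f zero k≤n = trans (·-constant-term (Φ (tail f))) (sym (·-constant-term (Ψ (tail f))))
      step (suc n) f (suc k) (s≤s k≤n) = begin
        (g · Φ (tail f)) (suc k)  ≈⟨ ·-tail (Φ (tail f)) k ⟩
        (tail g · Φ (tail f)) k
          ≈⟨ ·-localʳ k (tail g) (λ j j≤k → go n (tail f) j (ℕ.≤-trans j≤k k≤n)) ⟩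
        (tail g · Ψ (tail f)) k  ≈⟨ ·-tail (Ψ (tail f)) k ⟨
        (g · Ψ (tail f)) (suc k) ∎

    1-⋄ : 1ₛ ⋄ g ≋ 1ₛ
    1-⋄ = S.begin
      1ₛ ⋄ g                       S.≈⟨ ⋄-tail 1ₛ ⟩
      constant 1# +ₛ g · (0ₛ ⋄ g)  S.≈⟨ S.+-cong {constant 1#} (λ { zero → refl ; (suc n) → refl }) (S.*-congˡ {g} 0-⋄) ⟩
      1ₛ +ₛ g · 0ₛ                 S.≈⟨ S.+-congˡ {1ₛ} (S.zeroʳ g) ⟩
      1ₛ +ₛ 0ₛ                     S.≈⟨ S.+-identityʳ 1ₛ ⟩
      1ₛ S.∎
      where
      0-⋄ : 0ₛ ⋄ g ≋ 0ₛ
      0-⋄ n = ∑-zero (suc n) (λ k → 0# * (g ^ₛ k) n) (λ k → zeroˡ _)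

    -- For fixed f both sides satisfy Φ(h) = h(0) f(g) + g Φ(tail h).
    ⋄-· : ∀ h f → (h · f) ⋄ g ≋ (h ⋄ g) · (f ⋄ g)
    ⋄-· h f = recursion-unique (λ h → constant (h 0) · (f ⋄ g))
      (λ h → (h · f) ⋄ g) (λ h → (h ⋄ g) · (f ⋄ g)) left right h
      where
      constant-split : ∀ h → constant ((h · f) 0) ≋ constant (h 0) · constant (f 0)
      constant-split h zero    = refl
      constant-split h (suc n) = sym (trans (constant-· (h 0) (constant (f 0)) (suc n)) (zeroʳ _))
      ⋄-tail-· : ∀ h → tail (h · f) ⋄ g ≋ constant (h 0) · (tail f ⋄ g) +ₛ (tail h · f) ⋄ g
      ⋄-tail-· h n = trans (⋄-+ (λ k → h 0 * tail f k) (tail h · f) g n)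
        (+-congʳ (trans (*-⋄ (h 0) (tail f) g n) (sym (constant-· (h 0) (tail f ⋄ g) n))))
      left : ∀ h → (h · f) ⋄ g ≋ constant (h 0) · (f ⋄ g) +ₛ g · ((tail h · f) ⋄ g)
      left h = S.begin
        (h · f) ⋄ g
          S.≈⟨ ⋄-tail (h · f) ⟩
        constant ((h · f) 0) +ₛ g · (tail (h · f) ⋄ g)
          S.≈⟨ S.+-cong (constant-split h) (S.*-congˡ {g} (⋄-tail-· h)) ⟩
        constant (h 0) · constant (f 0) +ₛ g · (constant (h 0) · (tail f ⋄ g) +ₛ (tail h · f) ⋄ g)
          S.≈⟨ solveₛ 5 (λ a b g t u → a ⊗ b ⊕ g ⊗ (a ⊗ t ⊕ u) ⊜ a ⊗ (b ⊕ g ⊗ t) ⊕ g ⊗ u)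
               S.refl (constant (h 0)) (constant (f 0)) g (tail f ⋄ g) ((tail h · f) ⋄ g) ⟩
        constant (h 0) · (constant (f 0) +ₛ g · (tail f ⋄ g)) +ₛ g · ((tail h · f) ⋄ g)
          S.≈⟨ S.+-congʳ {g · ((tail h · f) ⋄ g)} (S.*-congˡ {constant (h 0)} (⋄-tail f)) ⟨
        constant (h 0) · (f ⋄ g) +ₛ g · ((tail h · f) ⋄ g) S.∎
      right : ∀ h → (h ⋄ g) · (f ⋄ g) ≋ constant (h 0) · (f ⋄ g) +ₛ g · ((tail h ⋄ g) · (f ⋄ g))
      right h = S.begin
        (h ⋄ g) · (f ⋄ g)
          S.≈⟨ S.*-congʳ {f ⋄ g} (⋄-tail h) ⟩
        (constant (h 0) +ₛ g · (tail h ⋄ g)) · (f ⋄ g)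
          S.≈⟨ solveₛ 4 (λ a g t u → (a ⊕ g ⊗ t) ⊗ u ⊜ a ⊗ u ⊕ g ⊗ (t ⊗ u))
               S.refl (constant (h 0)) g (tail h ⋄ g) (f ⋄ g) ⟩
        constant (h 0) · (f ⋄ g) +ₛ g · ((tail h ⋄ g) · (f ⋄ g)) S.∎

    -- Both sides satisfy Φ(h) = g′ (tail h)(g) + g Φ(tail h).
    chain-rule : ∀ h → (h ⋄ g) ′ ≋ ((h ′) ⋄ g) · g ′
    chain-rule = recursion-unique (λ h → g ′ · (tail h ⋄ g)) (λ h → (h ⋄ g) ′) (λ h → ((h ′) ⋄ g) · g ′) left right
      where
      left : ∀ h → (h ⋄ g) ′ ≋ g ′ · (tail h ⋄ g) +ₛ g · (tail h ⋄ g) ′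
      left h = S.begin
        (h ⋄ g) ′                               S.≈⟨ ′-cong (⋄-tail h) ⟩
        (constant (h 0) +ₛ g · (tail h ⋄ g)) ′  S.≈⟨ ′-+ (constant (h 0)) (g · (tail h ⋄ g)) ⟩
        constant (h 0) ′ +ₛ (g · (tail h ⋄ g)) ′
          S.≈⟨ S.+-cong (constant-′ (h 0)) (′-· g (tail h ⋄ g)) ⟩
        0ₛ +ₛ (g ′ · (tail h ⋄ g) +ₛ g · (tail h ⋄ g) ′)  S.≈⟨ S.+-identityˡ _ ⟩
        g ′ · (tail h ⋄ g) +ₛ g · (tail h ⋄ g) ′ S.∎
      right : ∀ h → ((h ′) ⋄ g) · g ′ ≋ g ′ · (tail h ⋄ g) +ₛ g · (((tail h ′) ⋄ g) · g ′)
      right h = S.begin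
        ((h ′) ⋄ g) · g ′
          S.≈⟨ S.*-congʳ {g ′} derivative ⟩
        (tail h ⋄ g +ₛ g · ((tail h ′) ⋄ g)) · g ′
          S.≈⟨ solveₛ 4 (λ t g u d → (t ⊕ g ⊗ u) ⊗ d ⊜ d ⊗ t ⊕ g ⊗ (u ⊗ d))
                 S.refl (tail h ⋄ g) g ((tail h ′) ⋄ g) (g ′) ⟩
        g ′ · (tail h ⋄ g) +ₛ g · (((tail h ′) ⋄ g) · g ′) S.∎
        where
        derivative : (h ′) ⋄ g ≋ tail h ⋄ g +ₛ g · ((tail h ′) ⋄ g)
        derivative = S.begin
          (h ′) ⋄ g                        S.≈⟨ ⋄-congʳ g (′-tail h) ⟩
          (tail h +ₛ (0# ∷ tail h ′)) ⋄ g  S.≈⟨ ⋄-+ (tail h) (0# ∷ tail h ′) g ⟩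
          tail h ⋄ g +ₛ (0# ∷ tail h ′) ⋄ g
            S.≈⟨ S.+-congˡ {tail h ⋄ g} (⋄-tail (0# ∷ tail h ′)) ⟩
          tail h ⋄ g +ₛ (constant 0# +ₛ g · ((tail h ′) ⋄ g))
            S.≈⟨ S.+-congˡ {tail h ⋄ g} (S.+-congʳ {g · ((tail h ′) ⋄ g)}
                   {constant 0#} {0ₛ} (λ { zero → refl ; (suc n) → refl })) ⟩
          tail h ⋄ g +ₛ (0ₛ +ₛ g · ((tail h ′) ⋄ g))
            S.≈⟨ S.+-congˡ {tail h ⋄ g} (S.+-identityˡ (g · ((tail h ′) ⋄ g))) ⟩
          tail h ⋄ g +ₛ g · ((tail h ′) ⋄ g) S.∎

  -- The logarithm

  -- The series 1 - x + x² - ⋯ = 1 / (1 + x).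
  alternating : Series
  alternating n = (- 1#) ^ n

  suc-n⋅1/[1+n] : ∀ n → suc n ⋅ 1/[1+ n ] ≈ 1#
  suc-n⋅1/[1+n] n = trans (sym (n⋅1*x (suc n) 1/[1+ n ])) (inverseʳ (char0 (suc n)))

  ln1+x′ : ln1+x ′ ≋ alternating
  ln1+x′ n = begin
    suc n ⋅ ((- 1#) ^ n * 1/[1+ n ])  ≈⟨ ×-comm-* (suc n) _ _ ⟨
    (- 1#) ^ n * (suc n ⋅ 1/[1+ n ])  ≈⟨ *-congˡ (suc-n⋅1/[1+n] n) ⟩
    (- 1#) ^ n * 1#                   ≈⟨ *-identityʳ _ ⟩
    (- 1#) ^ n ∎

  -- (1 / (1 + x)) ∘ u = 1 / (1 + u), by the recursion for substitution and
  -- tail alternating = - alternating.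
  alternating-⋄ : ∀ {u} → u 0 ≈ 0# → (alternating ⋄ u) · (1ₛ +ₛ u) ≋ 1ₛ
  alternating-⋄ {u} u₀≈0 = S.begin
    A · (1ₛ +ₛ u)    S.≈⟨ S.distribˡ A 1ₛ u ⟩
    A · 1ₛ +ₛ A · u  S.≈⟨ S.+-cong (S.*-identityʳ A) (S.*-comm A u) ⟩
    A +ₛ u · A       S.≈⟨ S.+-congʳ {u · A} (⋄-tail u₀≈0 alternating) ⟩
    constant 1# +ₛ u · (tail alternating ⋄ u) +ₛ u · A
      S.≈⟨ S.+-assoc (constant 1#) (u · (tail alternating ⋄ u)) (u · A) ⟩
    constant 1# +ₛ (u · (tail alternating ⋄ u) +ₛ u · A)
      S.≈⟨ S.+-cong {constant 1#} {1ₛ} (λ { zero → refl ; (suc n) → refl })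
             (S.sym (S.distribˡ u (tail alternating ⋄ u) A)) ⟩
    1ₛ +ₛ u · (tail alternating ⋄ u +ₛ A)
      S.≈⟨ S.+-congˡ {1ₛ} (S.trans (S.*-congˡ {u} cancel) (S.zeroʳ u)) ⟩
    1ₛ +ₛ 0ₛ  S.≈⟨ S.+-identityʳ 1ₛ ⟩
    1ₛ S.∎
    where
    A = alternating ⋄ u
    cancel : tail alternating ⋄ u +ₛ A ≋ 0ₛ
    cancel n = begin
      (tail alternating ⋄ u) n + A n  ≈⟨ +-congʳ (*-⋄ (- 1#) alternating u n) ⟩
      - 1# * A n + A n                ≈⟨ +-congʳ (-1*x≈-x (A n)) ⟩
      - A n + A n                     ≈⟨ -‿inverseˡ (A n) ⟩
      0# ∎

  -- The logarithm of e is the series without constant term whose derivative is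
  -- e′ / e.
  ln-unique : ∀ {e g} → e 0 ≈ 1# → g 0 ≈ 0# → e ′ ≋ e · g ′ → ln e ≋ g
  ln-unique {e} {g} e₀≈1 g₀≈0 e′≋eg′ = ′-injective
    (trans (⋄-constant-term ln1+x u) (sym g₀≈0)) (S.begin
      (ln1+x ⋄ u) ′                  S.≈⟨ chain-rule u₀≈0 ln1+x ⟩
      ((ln1+x ′) ⋄ u) · u ′          S.≈⟨ ·-cong (⋄-congʳ u ln1+x′) u′≋e′ ⟩
      (alternating ⋄ u) · e ′        S.≈⟨ S.*-congˡ {alternating ⋄ u} e′≋eg′ ⟩
      (alternating ⋄ u) · (e · g ′)  S.≈⟨ S.*-assoc (alternating ⋄ u) e (g ′) ⟨
      (alternating ⋄ u) · e · g ′
        S.≈⟨ S.*-congʳ {g ′} (S.*-congˡ {alternating ⋄ u} e≋1+u) ⟩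
      (alternating ⋄ u) · (1ₛ +ₛ u) · g ′  S.≈⟨ S.*-congʳ {g ′} (alternating-⋄ u₀≈0) ⟩
      1ₛ · g ′                             S.≈⟨ S.*-identityˡ (g ′) ⟩
      g ′                                      S.∎)
    where
    u : Series
    u = e -ₛ 1ₛ
    u₀≈0 : u 0 ≈ 0#
    u₀≈0 = trans (+-congʳ e₀≈1) (-‿inverseʳ 1#)
    e≋1+u : e ≋ 1ₛ +ₛ u
    e≋1+u n = begin
      e n                    ≈⟨ +-identityʳ (e n) ⟨
      e n + 0#               ≈⟨ +-congˡ (-‿inverseˡ (1ₛ n)) ⟨
      e n + (- 1ₛ n + 1ₛ n)  ≈⟨ +-assoc (e n) (- 1ₛ n) (1ₛ n) ⟨
      e n - 1ₛ n + 1ₛ n      ≈⟨ +-comm (e n - 1ₛ n) (1ₛ n) ⟩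
      1ₛ n + (e n - 1ₛ n) ∎
    u′≋e′ : u ′ ≋ e ′
    u′≋e′ = S.begin
      u ′          S.≈⟨ S.+-identityˡ (u ′) ⟨
      0ₛ +ₛ u ′    S.≈⟨ S.+-congʳ {u ′} 1ₛ-′ ⟨
      1ₛ ′ +ₛ u ′  S.≈⟨ ′-+ 1ₛ u ⟨
      (1ₛ +ₛ u) ′  S.≈⟨ ′-cong e≋1+u ⟨
      e ′ S.∎

  -- The exponential series

  n!⋅1/[n!] : ∀ n → (n !) ⋅ 1/[ n !] ≈ 1#
  n!⋅1/[n!] n = trans (sym (n⋅1*x (n !) 1/[ n !])) (inverseʳ (char0 (n !) {{n ℕ.!≢0}}))

  -- Both (n + 1) / (n + 1)! and 1 / n! are inverse to n!.
  exp′ : exp ′ ≋ exp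
  exp′ n = begin
    suc n ⋅ (1# * 1/[ suc n !])                  ≈⟨ ×-congʳ (suc n) (*-identityˡ _) ⟩
    suc n ⋅ 1/[ suc n !]                         ≈⟨ *-identityʳ _ ⟨
    (suc n ⋅ 1/[ suc n !]) * 1#                  ≈⟨ *-congˡ (n!⋅1/[n!] n) ⟨
    (suc n ⋅ 1/[ suc n !]) * ((n !) ⋅ 1/[ n !])  ≈⟨ ×-comm-* (n !) _ _ ⟩
    (n !) ⋅ ((suc n ⋅ 1/[ suc n !]) * 1/[ n !])  ≈⟨ ×-assoc-* (n !) _ _ ⟨
    ((n !) ⋅ (suc n ⋅ 1/[ suc n !])) * 1/[ n !]  ≈⟨ *-congʳ (×-assocˡ _ (n !) (suc n)) ⟩
    ((n !) ℕ.* suc n) ⋅ 1/[ suc n !] * 1/[ n !]  ≈⟨ *-congʳ (×-congˡ (ℕ.*-comm (n !) (suc n))) ⟩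
    (suc n !) ⋅ 1/[ suc n !] * 1/[ n !]          ≈⟨ *-congʳ (n!⋅1/[n!] (suc n)) ⟩
    1# * 1/[ n !] ∎

  exp-constant-term : exp 0 ≈ 1#
  exp-constant-term = begin
    1# * 1/[ 0 !]  ≈⟨ *-identityˡ _ ⟩
    1/[ 0 !]       ≈⟨ +-identityʳ _ ⟨
    1 ⋅ 1/[ 0 !]   ≈⟨ n!⋅1/[n!] 0 ⟩
    1# ∎

  -- The compositional inverse

  module _ {f g : Series} (f′₀#0 : HeytingField._#_ K ((f ′) 0) 0#) (inv : IsCompositionalInverse f g) where

    open IsCompositionalInverse inv renaming (constant-term to g₀≈0; right-inverse to f⋄g≋X)

    -- The series 1 / f′.
    R : Series
    R = reciprocal (f ′) f′₀#0

    -- The operator (1 / f′) d/dx.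
    D : Series → Series
    D h = R · h ′

    -- f′(g) g′ = 1, multiplied by (1 / f′)(g).
    inverse′ : g ′ ≋ R ⋄ g
    inverse′ = S.begin
      g ′                    S.≈⟨ S.*-identityˡ (g ′) ⟨
      1ₛ · g ′               S.≈⟨ S.*-congʳ {g ′} (1-⋄ g₀≈0) ⟨
      (1ₛ ⋄ g) · g ′         S.≈⟨ S.*-congʳ {g ′} (⋄-congʳ g (reciprocal-inverseʳ (f ′) f′₀#0)) ⟨
      ((f ′ · R) ⋄ g) · g ′  S.≈⟨ S.*-congʳ {g ′} (⋄-· g₀≈0 (f ′) R) ⟩
      ((f ′) ⋄ g) · (R ⋄ g) · g ′
        S.≈⟨ solveₛ 3 (λ a r d → a ⊗ r ⊗ d ⊜ a ⊗ d ⊗ r) S.refl ((f ′) ⋄ g) (R ⋄ g) (g ′) ⟩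
      ((f ′) ⋄ g) · g ′ · (R ⋄ g)  S.≈⟨ S.*-congʳ {R ⋄ g} (chain-rule g₀≈0 f) ⟨
      (f ⋄ g) ′ · (R ⋄ g)          S.≈⟨ S.*-congʳ {R ⋄ g} (S.trans (′-cong f⋄g≋X) X′) ⟩
      1ₛ · (R ⋄ g)                 S.≈⟨ S.*-identityˡ (R ⋄ g) ⟩
      R ⋄ g S.∎

    ⋄-inverse′ : ∀ h → (h ⋄ g) ′ ≋ D h ⋄ g
    ⋄-inverse′ h = S.begin
      (h ⋄ g) ′              S.≈⟨ chain-rule g₀≈0 h ⟩
      ((h ′) ⋄ g) · g ′      S.≈⟨ S.*-congˡ {(h ′) ⋄ g} inverse′ ⟩
      ((h ′) ⋄ g) · (R ⋄ g)  S.≈⟨ S.*-comm ((h ′) ⋄ g) (R ⋄ g) ⟩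
      (R ⋄ g) · ((h ′) ⋄ g)  S.≈⟨ ⋄-· g₀≈0 R (h ′) ⟨
      (R · h ′) ⋄ g S.∎

    -- The m-th derivative of h(g) at 0.  The induction is on m for all h at once,
    -- since iterate applies D first to h.
    iterate-D : ∀ h m → iterate D h m 0 ≈ (m !) ⋅ (h ⋄ g) m
    iterate-D h zero    = begin
      h 0        ≈⟨ ⋄-constant-term h g ⟨
      (h ⋄ g) 0  ≈⟨ +-identityʳ _ ⟨
      1 ⋅ (h ⋄ g) 0 ∎
    iterate-D h (suc m) = begin
      iterate D (D h) m 0                  ≈⟨ iterate-D (D h) m ⟩
      (m !) ⋅ (D h ⋄ g) m                  ≈⟨ ×-congʳ (m !) (⋄-inverse′ h m) ⟨
      (m !) ⋅ (suc m ⋅ (h ⋄ g) (suc m))    ≈⟨ ×-assocˡ _ (m !) (suc m) ⟩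
      ((m !) ℕ.* suc m) ⋅ (h ⋄ g) (suc m)  ≈⟨ ×-congˡ (ℕ.*-comm (m !) (suc m)) ⟩
      (suc m !) ⋅ (h ⋄ g) (suc m) ∎

    egf-iterate-D : ∀ h → egf (λ m → iterate D h m 0) ≋ h ⋄ g
    egf-iterate-D h m = begin
      iterate D h m 0 * 1/[ m !]      ≈⟨ *-congʳ (iterate-D h m) ⟩
      (m !) ⋅ (h ⋄ g) m * 1/[ m !]    ≈⟨ ×-assoc-* (m !) _ _ ⟩
      (m !) ⋅ ((h ⋄ g) m * 1/[ m !])  ≈⟨ ×-comm-* (m !) _ _ ⟨
      (h ⋄ g) m * ((m !) ⋅ 1/[ m !])  ≈⟨ *-congˡ (n!⋅1/[n!] m) ⟩
      (h ⋄ g) m * 1#                  ≈⟨ *-identityʳ _ ⟩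
      (h ⋄ g) m ∎

    inverse-formula : g ≋ ln (egf λ m → iterate D exp m 0)
    inverse-formula = S.sym (ln-unique E₀≈1 g₀≈0 (S.begin
      E ′                  S.≈⟨ ′-cong (egf-iterate-D exp) ⟩
      (exp ⋄ g) ′          S.≈⟨ chain-rule g₀≈0 exp ⟩
      ((exp ′) ⋄ g) · g ′  S.≈⟨ S.*-congʳ {g ′} (⋄-congʳ g exp′) ⟩
      (exp ⋄ g) · g ′      S.≈⟨ S.*-congʳ {g ′} (egf-iterate-D exp) ⟨
      E · g ′                S.∎))
      where
      E : Series
      E = egf λ m → iterate D exp m 0
      E₀≈1 : E 0 ≈ 1#
      E₀≈1 = trans (egf-iterate-D exp 0) (trans (⋄-constant-term exp g) exp-constant-term)

open import Defs

theorem1 :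
    (a : ℕ → ℂ) → a 0 ≈ᶜ 0ᶜ → (a₁#0 : a 1 #ᶜ 0ᶜ) →
    (f⁻¹ : Series) → IsCompositionalInverse (egf a) f⁻¹ →
    f⁻¹ ≋ ln (egf λ m → iterate (λ h → reciprocal (egf a ′) (egf′-#0 a a₁#0) · h ′) exp m 0)
theorem1 a _ a₁#0 f⁻¹ inv = inverse-formula ℂ-heytingField ℂ-characteristicZero (egf′-#0 a a₁#0) inv
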